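{- The Local Days On Days Off Scheduling Problem (LDODOSP) can be decided in $\mathcal{O}(D^2)$ time.
   Context: An instance of the Days On Days Off Scheduling Problem (DODOSP) consists of integers $D\ge 1$ (days), $N\ge 1$ (workers), bounds $l_w,u_w,l_o,u_o,U_w,U_o\in\mathbb{N}$, and for each day $d\in\{1,\dots,D\}$ integers $0\le r_l^d\le r_u^d\le N$. A schedule is a map $f:\{n_1,\dots,n_N\}\times\{1,\dots,D\}\to\{\mathrm{ON},\mathrm{OFF}\}$ (not cyclic). A work period (resp. off period) of a worker is an inclusion-wise maximal set of consecutive days on which the worker is ON (resp. OFF). A schedule is feasible if on every day $d$ the number of workers that are ON lies in $[r_l^d,r_u^d]$, every work period has length between $l_w$ and $u_w$, every off period has length between $l_o$ and $u_o$, every worker is ON on at most $U_w$ days and OFF on at most $U_o$ days. The decision problem asks whether a feasible schedule exists. The LDODOSP is the DODOSP restricted to instances with $U_w=U_o=D$. -}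

module Defs where

open import Data.Bool using (Bool; true; false; if_then_else_)
open import Data.Fin as Fin using (Fin; toℕ)
open import Data.List using (List; []; _∷_; _++_; tabulate)
open import Data.Nat using (ℕ; zero; suc; _+_; _∸_; _≤_; _≡ᵇ_)
open import Data.Product using (_×_; ∃)
open import Data.Sum using (_⊎_; inj₁; inj₂)
open import Data.Vec using (count; allFin)
open import Relation.Binary.Definitions using (DecidableEquality)
open import Relation.Binary.PropositionalEquality using (_≡_; refl)
open import Relation.Nullary using (yes; no)

record Instance : Set where
  field
    D N             : ℕ
    1≤D             : 1 ≤ D
    1≤N             : 1 ≤ N
    lw uw lo uo     : ℕ
    Uw Uo           : ℕ
    rl ru           : Fin D → ℕ
    rl≤ru           : ∀ d → rl d ≤ ru d
    ru≤N            : ∀ d → ru d ≤ N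

data Duty : Set where
  ON OFF : Duty

_≟_ : DecidableEquality Duty
ON  ≟ ON  = yes refl
ON  ≟ OFF = no λ ()
OFF ≟ ON  = no λ ()
OFF ≟ OFF = yes refl

-- Days and workers are numbered from 0.
Schedule : ℕ → ℕ → Set
Schedule N D = Fin N → Fin D → Duty

workersOn : ∀ {N D} → Schedule N D → Fin D → ℕ
workersOn {N} f d = count (λ w → f w d ≟ ON) (allFin N)

daysWith : ∀ {N D} → Schedule N D → Duty → Fin N → ℕ
daysWith {D = D} f x w = count (λ d → f w d ≟ x) (allFin D)

-- A nonempty set of consecutive days is given by its first day a and its
-- last day b.
Run : ∀ {N D} → Schedule N D → Duty → Fin N → Fin D → Fin D → Set
Run f x w a b =
  a Fin.≤ b × (∀ d → a Fin.≤ d → d Fin.≤ b → f w d ≡ x)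

-- Work periods are the case x = ON, off periods the case x = OFF.
Period : ∀ {N D} → Schedule N D → Duty → Fin N → Fin D → Fin D → Set
Period f x w a b =
  Run f x w a b ×
  (∀ a′ b′ → a′ Fin.≤ a → b Fin.≤ b′ → Run f x w a′ b′ → a′ ≡ a × b′ ≡ b)

periodLength : ∀ {D} → Fin D → Fin D → ℕ
periodLength a b = suc (toℕ b) ∸ toℕ a

record Feasible (I : Instance) (f : Schedule (Instance.N I) (Instance.D I)) : Set where
  open Instance I
  field
    staffing : ∀ d → rl d ≤ workersOn f d × workersOn f d ≤ ru d
    work     : ∀ w a b → Period f ON w a b →
               lw ≤ periodLength a b × periodLength a b ≤ uw
    off      : ∀ w a b → Period f OFF w a b →
               lo ≤ periodLength a b × periodLength a b ≤ uo
    totalOn  : ∀ w → daysWith f ON w ≤ Uw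
    totalOff : ∀ w → daysWith f OFF w ≤ Uo

DODOSP : Instance → Set
DODOSP I = ∃ λ f → Feasible I f

IsLocal : Instance → Set
IsLocal I = Uw ≡ D × Uo ≡ D
  where open Instance I

-- The model of computation is the unit-cost random access machine.
-- Registers are named by the program, so each program uses finitely many;
-- the memory is addressed indirectly, through registers.  All cells hold
-- natural numbers.  There is no multiplication, so that in t steps numbers
-- grow by at most t bits (plus a constant depending on the program), and
-- unit cost per instruction is the usual (polynomially honest) time measure.
-- Comparisons are made by truncated subtraction followed by jz.

Reg Label : Set
Reg   = ℕ
Label = ℕ

data Instr : Set where
  const : (dst : Reg) (k : ℕ)        → Instr   -- dst := k
  add   : (dst src₁ src₂ : Reg)      → Instr   -- dst := src₁ + src₂
  sub   : (dst src₁ src₂ : Reg)      → Instr   -- dst := src₁ ∸ src₂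
  load  : (dst addr : Reg)           → Instr   -- dst := mem[addr]
  store : (addr src : Reg)           → Instr   -- mem[addr] := src
  jump  : (target : Label)           → Instr
  jz    : (src : Reg) (target : Label) → Instr -- jump if src = 0
  halt  : (answer : Bool)            → Instr

Program : Set
Program = List Instr

record Config : Set where
  constructor ⟨_,_,_⟩
  field
    pc  : Label
    reg : Reg → ℕ
    mem : ℕ → ℕ

_[_↦_] : (ℕ → ℕ) → ℕ → ℕ → (ℕ → ℕ)
(g [ i ↦ v ]) j = if j ≡ᵇ i then v else g j

lookupOr : {A : Set} → A → List A → ℕ → A
lookupOr z []       _       = z
lookupOr z (x ∷ _)  zero    = x
lookupOr z (_ ∷ xs) (suc i) = lookupOr z xs i

-- Control leaving the program halts with a negative answer.
fetch : Program → Label → Instr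
fetch = lookupOr (halt false)

exec : Instr → Config → Config ⊎ Bool
exec (const r k) ⟨ pc , R , M ⟩ = inj₁ ⟨ suc pc , R [ r ↦ k ] , M ⟩
exec (add r s t) ⟨ pc , R , M ⟩ = inj₁ ⟨ suc pc , R [ r ↦ R s + R t ] , M ⟩
exec (sub r s t) ⟨ pc , R , M ⟩ = inj₁ ⟨ suc pc , R [ r ↦ R s ∸ R t ] , M ⟩
exec (load r s)  ⟨ pc , R , M ⟩ = inj₁ ⟨ suc pc , R [ r ↦ M (R s) ] , M ⟩
exec (store r s) ⟨ pc , R , M ⟩ = inj₁ ⟨ suc pc , R , M [ R r ↦ R s ] ⟩
exec (jump l)    ⟨ pc , R , M ⟩ = inj₁ ⟨ l , R , M ⟩
exec (jz r l)    ⟨ pc , R , M ⟩ =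
  inj₁ ⟨ (if R r ≡ᵇ 0 then l else suc pc) , R , M ⟩
exec (halt b)    _              = inj₂ b

step : Program → Config → Config ⊎ Bool
step p σ = exec (fetch p (Config.pc σ)) σ

-- p ⊢ σ ⇓[ t ] b: started in σ, the program p executes exactly t
-- instructions, the last of which halts with answer b.
data _⊢_⇓[_]_ (p : Program) : Config → ℕ → Bool → Set where
  stop : ∀ {σ b} → step p σ ≡ inj₂ b → p ⊢ σ ⇓[ 1 ] b
  next : ∀ {σ σ′ t b} → step p σ ≡ inj₁ σ′ → p ⊢ σ′ ⇓[ t ] b → p ⊢ σ ⇓[ suc t ] b

-- The input is placed in memory from address 0 on; everything else is 0.
initial : List ℕ → Config
initial xs = ⟨ 0 , (λ _ → 0) , lookupOr 0 xs ⟩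

encode : Instance → List ℕ
encode I =
  D ∷ N ∷ lw ∷ uw ∷ lo ∷ uo ∷ Uw ∷ Uo ∷ tabulate rl ++ tabulate ru
  where open Instance I

{-# OPTIONS --safe #-}
module Submission where

-- Let S and T count the work periods begun and ended by all workers together up to a day.  Serving
-- the workers cyclically, so that worker w gets ⌊(S + w) / N⌋ and ⌊(T + w) / N⌋ of them, shows that
-- only S and T matter: a feasible schedule exists if and only if S and T satisfy O(D) difference
-- constraints, such as T d ≤ S (d ∸ lw) for work periods that are not too short.  These are
-- solved by O(D) Bellman–Ford rounds of O(D) steps, starting from 0 and raising values in place.

open import Defs
open import Algebra.Properties.CommutativeMonoid.Sum using ()
open import Data.Bool using (Bool; true; false; if_then_else_; _∧_) renaming (T to IsTrue)
open import Data.Empty using (⊥-elim)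
open import Data.Fin as Fin using (Fin; toℕ; fromℕ<)
open import Data.Fin.Properties using (toℕ<n; toℕ-fromℕ<; toℕ-injective)
open import Data.List using (List; []; _∷_; _++_; tabulate; drop; length; map)
open import Data.List.Properties using (length-++; length-tabulate; ++-identityʳ)
open import Data.List.Relation.Unary.All as All using (All; []; _∷_)
import Data.List.Relation.Unary.All.Properties as All
open import Data.Nat hiding (_≟_)
open import Data.Nat.DivMod using (/-monoˡ-≤; m<n⇒m/n≡0; n/n≡1; +-distrib-/-∣ʳ)
open import Data.Nat.Divisibility using (∣-refl)
open import Data.Nat.Properties renaming (_≟_ to _≟ℕ_)
open import Data.Nat.Solver using (module +-*-Solver)
open import Data.Product using (_×_; ∃; ∃₂; _,_; proj₁; proj₂)
open import Data.Sum using (_⊎_; inj₁; inj₂)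
open import Data.Vec as Vec using (count; allFin)
open import Data.Vec.Properties using (count≤n)
open import Function using (_∘_; id)
open import Relation.Binary.PropositionalEquality
open import Relation.Nullary using (Reflects; ofʸ; ofⁿ; ¬_; yes; no; Dec; contradiction)

open Algebra.Properties.CommutativeMonoid.Sum +-0-commutativeMonoid
  using (sum; sum-cong-≗; ∑-distrib-+)

-- Sums of natural numbers

-- The time bound does not mention `N`, so the machine cannot treat the workers one by one; this
-- forces the compression to two totals. Nothing is lost because each constraint compares two
-- counter values at shifted indices, so every monotone map preserves it. The map n ↦ ⌊(n + w) / N⌋
-- is monotone, turns the constant `N` of the off constraints into 1, and its values over all w add
-- up to n again (Hermite's identity). Off periods need no counters of their own: they begin where
-- work periods end, so `T + N` and `S` take the roles of `S` and `T`. The horizon is not cyclic.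
-- Its start is handled by a fictitious index 0 carrying the duty opposite to that of the first day,
-- its end by a constraint on the periods still running on the last day. Convergence is proved
-- without paths or cycles: a solution above the current values is lowered until, with each round,
-- it meets them at one more vertex. One extra round tests the outcome: it raises nothing exactly
-- when all constraints hold.

sum-mono-≤ : ∀ {n} {f g : Fin n → ℕ} → (∀ i → f i ≤ g i) → sum f ≤ sum g
sum-mono-≤ {zero}  f≤g = z≤n
sum-mono-≤ {suc n} f≤g = +-mono-≤ (f≤g Fin.zero) (sum-mono-≤ (f≤g ∘ Fin.suc))

-- Either the sum makes strict progress or nothing changes anywhere. In the convergence proof this
-- dichotomy replaces the search for an individual vertex.
sum-<⊎≥ : ∀ {n} {f g : Fin n → ℕ} → (∀ i → f i ≤ g i) →
          sum f < sum g ⊎ (∀ i → g i ≤ f i)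
sum-<⊎≥ {zero} f≤g = inj₂ λ ()
sum-<⊎≥ {suc n} {f} {g} f≤g
  with f Fin.zero <? g Fin.zero | sum-<⊎≥ (f≤g ∘ Fin.suc)
... | yes f₀<g₀ | _         = inj₁ (+-mono-<-≤ f₀<g₀ (sum-mono-≤ (f≤g ∘ Fin.suc)))
... | no  _     | inj₁ lt   = inj₁ (+-mono-≤-< (f≤g Fin.zero) lt)
... | no  f₀≮g₀ | inj₂ g≤f  = inj₂ λ where
  Fin.zero    → ≮⇒≥ f₀≮g₀
  (Fin.suc i) → g≤f i

sum-0 : ∀ n {f : Fin n → ℕ} → (∀ i → f i ≡ 0) → sum f ≡ 0
sum-0 zero    f≡0 = refl
sum-0 (suc n) f≡0 = cong₂ _+_ (f≡0 Fin.zero) (sum-0 n (f≡0 ∘ Fin.suc))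

sum-1 : ∀ n → sum {n} (λ _ → 1) ≡ n
sum-1 zero    = refl
sum-1 (suc n) = cong suc (sum-1 n)

sum-suc : ∀ {n} (f : Fin n → ℕ) → sum (λ i → f i + 1) ≡ sum f + n
sum-suc {n} f = trans (∑-distrib-+ f (λ _ → 1)) (cong (sum f +_) (sum-1 n))

sum-shift : ∀ n (f : ℕ → ℕ) →
            sum {n} (λ i → f (suc (toℕ i))) + f 0 ≡ sum {n} (λ i → f (toℕ i)) + f n
sum-shift zero    f = refl
sum-shift (suc n) f = begin
  f 1 + a + f 0            ≡⟨ +-comm (f 1 + a) (f 0) ⟩
  f 0 + (f 1 + a)          ≡⟨ cong (f 0 +_) (+-comm (f 1) a) ⟩
  f 0 + (a + f 1)          ≡⟨ cong (f 0 +_) (sum-shift n (f ∘ suc)) ⟩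
  f 0 + (b + f (suc n))    ≡⟨ sym (+-assoc (f 0) b _) ⟩
  f 0 + b + f (suc n)      ∎
  where
  open ≡-Reasoning
  a b : ℕ
  a = sum {n} (λ i → f (suc (suc (toℕ i))))
  b = sum {n} (λ i → f (suc (toℕ i)))

[m+n]/n : ∀ m n .{{_ : NonZero n}} → (m + n) / n ≡ m / n + 1
[m+n]/n m n = trans (+-distrib-/-∣ʳ m ∣-refl) (cong (m / n +_) (n/n≡1 n))

-- Raising `m` by 1 shifts the summands by one place: m / n leaves at the front and (m + n) / n = m
-- / n + 1 enters at the back, so the sum grows by exactly 1.
hermite-identity : ∀ n .{{_ : NonZero n}} m → sum {n} (λ i → (m + toℕ i) / n) ≡ m
hermite-identity n zero    = sum-0 n λ i → m<n⇒m/n≡0 (toℕ<n i)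
hermite-identity n (suc m) = +-cancelʳ-≡ _ _ _ (begin
  sum {n} (λ i → (suc m + toℕ i) / n) + (m + 0) / n
    ≡⟨ cong (_+ (m + 0) / n) (sum-cong-≗ {n} (λ i → cong (_/ n) (sym (+-suc m (toℕ i))))) ⟩
  sum {n} (λ i → (m + suc (toℕ i)) / n) + (m + 0) / n
    ≡⟨ sum-shift n (λ k → (m + k) / n) ⟩
  sum {n} (λ i → (m + toℕ i) / n) + (m + n) / n
    ≡⟨ cong₂ _+_ (hermite-identity n m) (trans ([m+n]/n m n) (cong (λ k → k / n + 1) (sym (+-identityʳ m)))) ⟩
  m + ((m + 0) / n + 1)
    ≡⟨ cong (m +_) (+-comm _ 1) ⟩
  m + suc ((m + 0) / n)
    ≡⟨ +-suc m _ ⟩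
  suc m + (m + 0) / n ∎)
  where open ≡-Reasoning

-- Difference constraints

record Edge : Set where
  constructor edge
  field
    tgt src pos neg : ℕ

open Edge

Holds : (ℕ → ℕ) → Edge → Set
Holds y e = y (src e) + pos e ≤ y (tgt e) + neg e

-- Truncation is harmless: in ℕ, m ∸ n ≤ o if and only if m ≤ o + n.
excess : (ℕ → ℕ) → Edge → ℕ
excess x e = x (src e) + pos e ∸ neg e ∸ x (tgt e)

relax : (ℕ → ℕ) → Edge → (ℕ → ℕ)
relax x e = x [ tgt e ↦ x (tgt e) + excess x e ]

relaxAll : (ℕ → ℕ) → List Edge → (ℕ → ℕ)
relaxAll x []       = x
relaxAll x (e ∷ es) = relaxAll (relax x e) es

totalExcess : (ℕ → ℕ) → List Edge → ℕ
totalExcess x []       = 0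
totalExcess x (e ∷ es) = excess x e + totalExcess (relax x e) es

relaxAll-++ : ∀ x es fs → relaxAll x (es ++ fs) ≡ relaxAll (relaxAll x es) fs
relaxAll-++ x []       fs = refl
relaxAll-++ x (e ∷ es) fs = relaxAll-++ (relax x e) es fs

totalExcess-++ : ∀ x es fs → totalExcess x (es ++ fs) ≡ totalExcess x es + totalExcess (relaxAll x es) fs
totalExcess-++ x []       fs = refl
totalExcess-++ x (e ∷ es) fs = trans (cong (excess x e +_) (totalExcess-++ (relax x e) es fs))
  (sym (+-assoc (excess x e) _ _))

update-∉ : ∀ (g : ℕ → ℕ) {i j v} → j ≢ i → (g [ i ↦ v ]) j ≡ g j
update-∉ g {i} {j} j≢i with j ≡ᵇ i in eq
... | true  = contradiction (≡ᵇ⇒≡ j i (subst IsTrue (sym eq) _)) j≢i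
... | false = refl

update-∈ : ∀ (g : ℕ → ℕ) i {v} → (g [ i ↦ v ]) i ≡ v
update-∈ g i with i ≡ᵇ i in eq
... | true  = refl
... | false = ⊥-elim (subst IsTrue eq (≡⇒≡ᵇ i i refl))

update-ind : ∀ {ℓ} (P : ℕ → ℕ → Set ℓ) (g : ℕ → ℕ) {i v} →
             P i v → (∀ j → P j (g j)) → ∀ j → P j ((g [ i ↦ v ]) j)
update-ind P g {i} pi pg j with j ≡ᵇ i in eq
... | true  = subst (λ k → P k _) (sym (≡ᵇ⇒≡ j i (subst IsTrue (sym eq) _))) pi
... | false = pg j

m+[n∸m]≤o : ∀ {m n o} → m ≤ o → n ≤ o → m + (n ∸ m) ≤ o
m+[n∸m]≤o {m} {n} m≤o n≤o with ≤-total m n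
... | inj₁ m≤n rewrite m+[n∸m]≡n m≤n = n≤o
... | inj₂ n≤m rewrite m≤n⇒m∸n≡0 n≤m | +-identityʳ m = m≤o

m≤n+o⇒m∸o≤n : ∀ {m n o} → m ≤ n + o → m ∸ o ≤ n
m≤n+o⇒m∸o≤n {m} {n} {o} le = ≤-trans (∸-monoˡ-≤ o le) (≤-reflexive (m+n∸n≡m n o))

m∸o≤n⇒m≤n+o : ∀ {m n o} → m ∸ o ≤ n → m ≤ n + o
m∸o≤n⇒m≤n+o {m} {n} {o} le = ≤-trans (m≤n+m∸n m o) (≤-trans (≤-reflexive (+-comm o _)) (+-monoˡ-≤ o le))

relax-≥ : ∀ x e v → x v ≤ relax x e v
relax-≥ x e = update-ind (λ v xv → x v ≤ xv) x (m≤m+n _ _) (λ _ → ≤-refl)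

relaxAll-≥ : ∀ x es v → x v ≤ relaxAll x es v
relaxAll-≥ x []       v = ≤-refl
relaxAll-≥ x (e ∷ es) v = ≤-trans (relax-≥ x e v) (relaxAll-≥ (relax x e) es v)

relax-holds : ∀ x e → x (src e) + pos e ≤ relax x e (tgt e) + neg e
relax-holds x e = m∸o≤n⇒m≤n+o (subst (x (src e) + pos e ∸ neg e ≤_) (sym (update-∈ x (tgt e)))
  (m≤n+m∸n _ (x (tgt e))))

-- The old value of the source is set against the new value of the target. In this mixed form the
-- bound survives all other relaxations of the round, since values only grow, and the order of the
-- edges is irrelevant.
relaxAll-holds : ∀ x es → All (λ e → x (src e) + pos e ≤ relaxAll x es (tgt e) + neg e) es
relaxAll-holds x []       = []
relaxAll-holds x (e ∷ es) =
  ≤-trans (relax-holds x e) (+-monoˡ-≤ (neg e) (relaxAll-≥ (relax x e) es (tgt e))) ∷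
  All.map (λ {e′} → ≤-trans (+-monoˡ-≤ (pos e′) (relax-≥ x e (src e′)))) (relaxAll-holds (relax x e) es)

Below : ℕ → Edge → Set
Below W e = tgt e < W × src e < W

-- The new value is the larger of the old value and the bound forced by the edge; a solution above
-- `x` dominates both.
relax-≤ : ∀ {W x y e} → (∀ v → v < W → x v ≤ y v) → Below W e → Holds y e →
          ∀ v → v < W → relax x e v ≤ y v
relax-≤ {W} {x} {y} {e} x≤y (t<W , s<W) he = update-ind (λ v xv → v < W → xv ≤ y v) x
  (λ _ → m+[n∸m]≤o (x≤y _ t<W)
    (m≤n+o⇒m∸o≤n (≤-trans (+-monoˡ-≤ (pos e) (x≤y _ s<W)) he))) x≤y

relaxAll-≤ : ∀ {W x y es} → (∀ v → v < W → x v ≤ y v) → All (Below W) es → All (Holds y) es →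
             ∀ v → v < W → relaxAll x es v ≤ y v
relaxAll-≤ x≤y []       []       = x≤y
relaxAll-≤ x≤y (b ∷ bs) (h ∷ hs) = relaxAll-≤ (relax-≤ x≤y b h) bs hs

relax-outside : ∀ x {e v} → v ≢ tgt e → relax x e v ≡ x v
relax-outside x = update-∉ x

relaxAll-outside : ∀ x {es v} → All (λ e → v ≢ tgt e) es → relaxAll x es v ≡ x v
relaxAll-outside x []                 = refl
relaxAll-outside x (_∷_ {x = e} p ps) =
  trans (relaxAll-outside (relax x e) ps) (relax-outside x {e} p)

relax-idle : ∀ x e → excess x e ≡ 0 → ∀ v → relax x e v ≡ x v
relax-idle x e eq = update-ind (λ v xv → xv ≡ x v) x
  (trans (cong (x (tgt e) +_) eq) (+-identityʳ _)) (λ _ → refl)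

Holds-cong : ∀ {x y} → (∀ v → x v ≡ y v) → ∀ {e} → Holds x e → Holds y e
Holds-cong x≡y {e} = subst₂ _≤_ (cong (_+ pos e) (x≡y (src e))) (cong (_+ neg e) (x≡y (tgt e)))

-- Relaxation is in place, so an edge is tested against values that earlier edges may have changed.
-- If all summands are 0, no relaxation changed anything, and every test was made on `x` itself.
totalExcess≡0⇒holds : ∀ x es → totalExcess x es ≡ 0 → All (Holds x) es
totalExcess≡0⇒holds x []       _  = []
totalExcess≡0⇒holds x (e ∷ es) eq =
  m∸o≤n⇒m≤n+o {n = x (tgt e)} {neg e} (m∸n≡0⇒m≤n (m+n≡0⇒m≡0 (excess x e) eq)) ∷
  All.map (λ {e′} → Holds-cong (relax-idle x e (m+n≡0⇒m≡0 (excess x e) eq)) {e′})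
    (totalExcess≡0⇒holds (relax x e) es (m+n≡0⇒n≡0 (excess x e) eq))

holds⇒totalExcess≡0 : ∀ x es → All (Holds x) es → totalExcess x es ≡ 0
holds⇒totalExcess≡0 x []       []       = refl
holds⇒totalExcess≡0 x (e ∷ es) (h ∷ hs) = cong₂ _+_ idle
  (holds⇒totalExcess≡0 (relax x e) es
    (All.map (λ {e′} → Holds-cong (λ v → sym (relax-idle x e idle v)) {e′}) hs))
  where
  idle : excess x e ≡ 0
  idle = m≤n⇒m∸n≡0 (m≤n+o⇒m∸o≤n {n = x (tgt e)} {neg e} h)

-- Convergence of the Bellman-Ford rounds

module BellmanFord (W : ℕ) (es : List Edge) (below : All (Below W) es) where

  infix 4 _≼_
  _≼_ : (ℕ → ℕ) → (ℕ → ℕ) → Set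
  x ≼ y = ∀ v → v < W → x v ≤ y v

  round : (ℕ → ℕ) → (ℕ → ℕ)
  round x = relaxAll x es

  rounds : ℕ → (ℕ → ℕ) → (ℕ → ℕ)
  rounds zero    x = x
  rounds (suc k) x = round (rounds k x)

  -- The truth value of `x v < y v` as 0 or 1, so that the unsettled vertices are counted by a sum.
  gap : (ℕ → ℕ) → (ℕ → ℕ) → ℕ → ℕ
  gap x y v = 1 ⊓ (y v ∸ x v)

  unsettled : (ℕ → ℕ) → (ℕ → ℕ) → ℕ
  unsettled x y = sum {W} (λ v → gap x y (toℕ v))

  gap-anti : ∀ x x′ y y′ v → x v ≤ x′ v → y′ v ≤ y v → gap x′ y′ v ≤ gap x y v
  gap-anti _ _ _ _ v le le′ = ⊓-monoʳ-≤ 1 (∸-mono le′ le)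

  gap-reflects : ∀ x x′ y v → gap x y v ≤ gap x′ y v → x v < y v → x′ v < y v
  gap-reflects x x′ y v le lt with x′ v <? y v
  ... | yes lt′ = lt′
  ... | no  ≮ = contradiction
    (≤-trans (⊓-glb ≤-refl (m<n⇒0<n∸m lt)) (≤-trans le (≤-trans (m⊓n≤n 1 _)
      (≤-reflexive (m≤n⇒m∸n≡0 (≮⇒≥ ≮)))))) λ ()

  lower : (ℕ → ℕ) → (ℕ → ℕ) → (ℕ → ℕ)
  lower x y v with x v <? y v
  ... | yes _ = pred (y v)
  ... | no  _ = y v

  lower-≤ : ∀ x y v → lower x y v ≤ y v
  lower-≤ x y v with x v <? y v
  ... | yes _ = pred[n]≤n
  ... | no  _ = ≤-refl

  lower-≼ : ∀ {x x′ y : ℕ → ℕ} → x′ ≼ y → (∀ v → v < W → x v < y v → x′ v < y v) → x′ ≼ lower x y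
  lower-≼ {x} {x′} {y} x′≼y x′<y v v<W with x v <? y v
  ... | yes lt = suc[m]≤n⇒m≤pred[n] (x′<y v v<W lt)
  ... | no  _  = x′≼y v v<W

  lower-holds : ∀ {x x′ y : ℕ → ℕ} → x ≼ y → (∀ v → v < W → x v < y v → x′ v < y v) →
                ∀ {e} → Below W e → x (src e) + pos e ≤ x′ (tgt e) + neg e →
                Holds y e → Holds (lower x y) e
  lower-holds {x} {x′} {y} x≼y x′<y {e} (t<W , s<W) push h
    with x (tgt e) <? y (tgt e) | x (src e) <? y (src e)
  ... | no _ | yes _ = ≤-trans (+-monoˡ-≤ (pos e) pred[n]≤n) h
  ... | no _ | no _  = h
  -- The critical case: the target loses 1 while the source keeps its value. The round has pushed
  -- `x (src e)`, which is already `y (src e)`, along the edge and still left the target below `y`,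
  -- so the constraint has slack.
  ... | yes t | no s = begin
    y (src e) + pos e         ≤⟨ +-monoˡ-≤ (pos e) (≮⇒≥ s) ⟩
    x (src e) + pos e         ≤⟨ push ⟩
    x′ (tgt e) + neg e        ≤⟨ +-monoˡ-≤ (neg e) (suc[m]≤n⇒m≤pred[n] (x′<y (tgt e) t<W t)) ⟩
    pred (y (tgt e)) + neg e  ∎
    where open ≤-Reasoning
  ... | yes t | yes s with y (tgt e) | y (src e)
  ...   | suc _ | suc _ = ≤-pred h

  -- If a round settles no further vertex, lowering y on the unsettled ones keeps it a solution:
  -- a tight constraint from a settled vertex would have settled its target.
  round-settles : ∀ k n {x y} → sum {W} (λ v → y (toℕ v)) ≤ n → x ≼ y → All (Holds y) es →
                  unsettled x y ≤ suc k →
                  ∃ λ y′ → round x ≼ y′ × All (Holds y′) es × unsettled (round x) y′ ≤ k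
  round-settles k n {x} {y} Σy≤n x≼y hs u≤
    with sum-<⊎≥ {W} (λ v → gap-anti x (round x) y y (toℕ v) (relaxAll-≥ x es (toℕ v)) ≤-refl)
       | sum-<⊎≥ {W} {λ v → lower x y (toℕ v)} (λ v → lower-≤ x y (toℕ v))
  ... | inj₁ fewer | _ = y , relaxAll-≤ x≼y below hs , hs , ≤-pred (≤-trans fewer u≤)
  -- Lowering changes nothing, so no vertex is unsettled at all.
  ... | inj₂ same  | inj₂ y≤ = y , x′≼y , hs , ≤-trans (≤-reflexive (sum-0 W settled)) z≤n
    where
    x′≼y : round x ≼ y
    x′≼y = relaxAll-≤ x≼y below hs
    settled : ∀ v → gap (round x) y (toℕ v) ≡ 0
    settled v = n≤0⇒n≡0 (≤-trans (gap-anti x (round x) y y (toℕ v) (relaxAll-≥ x es (toℕ v)) ≤-refl) (≤-trans (m⊓n≤n 1 _)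
      (≤-reflexive (m≤n⇒m∸n≡0 (y≤x (y≤ v))))))
      where
      y≤x : y (toℕ v) ≤ lower x y (toℕ v) → y (toℕ v) ≤ x (toℕ v)
      y≤x le with x (toℕ v) <? y (toℕ v)
      ... | no  ≮ = ≮⇒≥ ≮
      ... | yes lt with y (toℕ v)
      ...   | suc m = contradiction le 1+n≰n
  -- Here `n` bounds the sum of `y` over the vertices, which every lowering strictly decreases; so
  -- the lowering comes to an end.
  round-settles k zero Σy≤n x≼y hs u≤ | inj₂ same | inj₁ smaller =
    contradiction (≤-trans smaller Σy≤n) λ ()
  round-settles k (suc n) {x} {y} Σy≤n x≼y hs u≤ | inj₂ same | inj₁ smaller =
    round-settles k n {x} {lower x y} (≤-pred (≤-trans smaller Σy≤n))
      (λ v v<W → ≤-trans (relaxAll-≥ x es v) (lower-≼ (relaxAll-≤ x≼y below hs) x′<y v v<W))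
      (All.zipWith (λ { {e} ((b , p) , h) → lower-holds {x} {round x} x≼y x′<y {e} b p h })
        (All.zip (below , relaxAll-holds x es) , hs))
      (≤-trans (sum-mono-≤ {W} λ v → gap-anti x x y (lower x y) (toℕ v) ≤-refl (lower-≤ x y (toℕ v))) u≤)
    where
    x′<y : ∀ v → v < W → x v < y v → round x v < y v
    x′<y v v<W = subst (λ v → x v < y v → round x v < y v) (toℕ-fromℕ< v<W)
      (gap-reflects x (round x) y _ (same (fromℕ< v<W)))

  rounds-settle : ∀ k {x y} → x ≼ y → All (Holds y) es → k ≤ W →
                  ∃ λ y′ → rounds k x ≼ y′ × All (Holds y′) es × unsettled (rounds k x) y′ ≤ W ∸ k
  rounds-settle zero {x} {y} x≼y hs _ = y , x≼y , hs ,
    ≤-trans (sum-mono-≤ {W} {g = λ _ → 1} (λ v → m⊓n≤m 1 _)) (≤-reflexive (sum-1 W))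
  rounds-settle (suc k) {x} x≼y hs k<W with rounds-settle k x≼y hs (<⇒≤ k<W)
  ... | y , le , hs′ , u≤ = round-settles (W ∸ suc k) _ ≤-refl le hs′
    (≤-trans u≤ (≤-reflexive (sym (trans (cong suc (sym (pred[m∸n]≡m∸[1+n] W k)))
      (suc-pred (W ∸ k) {{>-nonZero (m<n⇒0<n∸m k<W)}})))))

  -- The bound on the number of unsettled vertices falls from `W` to 0, so the final values coincide
  -- on all vertices with some solution, not necessarily the given `y`.
  rounds-solve : ∀ {x y} → x ≼ y → All (Holds y) es → All (Holds (rounds W x)) es
  rounds-solve {x} x≼y hs with rounds-settle W x≼y hs ≤-refl
  ... | y , le , hs′ , u≤ = All.zipWith (λ { {e} ((t<W , s<W) , h) →
      subst₂ _≤_ (cong (_+ pos e) (settled (src e) s<W)) (cong (_+ neg e) (settled (tgt e) t<W)) h })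
      (below , hs′)
    where
    unsettled≤0 : unsettled (rounds W x) y ≤ sum {W} (λ _ → 0)
    unsettled≤0 = ≤-trans u≤ (≤-trans (≤-reflexive (n∸n≡0 W)) z≤n)
    settled : ∀ v → v < W → y v ≡ rounds W x v
    settled v v<W with sum-<⊎≥ {W} {λ _ → 0} {λ v → gap (rounds W x) y (toℕ v)} (λ _ → z≤n)
    ... | inj₁ lt = contradiction unsettled≤0 (<⇒≱ lt)
    ... | inj₂ ≤0 = ≤-antisym
      (≮⇒≥ λ lt → contradiction (gap-reflects (rounds W x) y y v
        (≤-trans (subst (λ v → gap (rounds W x) y v ≤ 0) (toℕ-fromℕ< v<W) (≤0 (fromℕ< v<W))) z≤n) lt)
        (<-irrefl refl))
      (le v v<W)

-- Schedules and counters

-- The maximum of `l` and 1: a period has at least one day, whatever the bound says. Truncated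
-- subtraction lets the machine compute it without a branch.
minLength : ℕ → ℕ
minLength l = l + (1 ∸ l)

1≤minLength : ∀ l → 1 ≤ minLength l
1≤minLength zero    = ≤-refl
1≤minLength (suc l) = s≤s z≤n

-- With day d at index d + 1, P counts the periods begun and Q the periods ended up to an index.
-- Index 0 stands for the time before the first day, when every worker has the opposite duty.
record Counters (D l u : ℕ) (P Q : ℕ → ℕ) : Set where
  field
    P-mono : ∀ {i} → i < D → P i ≤ P (suc i)
    Q-mono : ∀ {i} → i < D → Q i ≤ Q (suc i)
    long   : ∀ {i} → i < D → Q (suc i) ≤ P (suc i ∸ minLength l)
    short  : ∀ {i} → i < D → P (suc i ∸ u) ≤ Q (suc i)
    first  : P 0 ≤ Q 1
    last   : P D ≤ P (suc D ∸ minLength l)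

mono-≤ : ∀ {D} {F : ℕ → ℕ} → (∀ {i} → i < D → F i ≤ F (suc i)) →
         ∀ {i j} → i ≤ j → j ≤ D → F i ≤ F j
mono-≤ {D} {F} step i≤j j≤D = go (≤⇒≤′ i≤j) j≤D
  where
  go : ∀ {i j} → i ≤′ j → j ≤ D → F i ≤ F j
  go ≤′-refl     _   = ≤-refl
  go (≤′-step p) j<D = ≤-trans (go p (<⇒≤ j<D)) (step j<D)

-- All fields are inequalities between bare counter values; the bounds `l` and `u` only shift
-- indices. Hence a constraint on totals passes to the share of each worker.
Counters-map : ∀ {D l u P Q} {φ : ℕ → ℕ} → (∀ {m n} → m ≤ n → φ m ≤ φ n) →
               Counters D l u P Q → Counters D l u (φ ∘ P) (φ ∘ Q)
Counters-map φ-mono c = record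
  { P-mono = φ-mono ∘ P-mono ; Q-mono = φ-mono ∘ Q-mono
  ; long   = φ-mono ∘ long   ; short  = φ-mono ∘ short
  ; first  = φ-mono first    ; last   = φ-mono last }
  where open Counters c

Counters-cong : ∀ {D l u P P′ Q} → (∀ i → P i ≡ P′ i) → Counters D l u P Q → Counters D l u P′ Q
Counters-cong {Q = Q} P≡ c = record
  { P-mono = λ {i} i<D → subst₂ _≤_ (P≡ i) (P≡ (suc i)) (P-mono i<D)
  ; Q-mono = Q-mono
  ; long   = λ {i} i<D → subst (Q (suc i) ≤_) (P≡ _) (long i<D)
  ; short  = λ {i} i<D → subst (_≤ Q (suc i)) (P≡ _) (short i<D)
  ; first  = subst (_≤ Q 1) (P≡ 0) first
  ; last   = subst₂ _≤_ (P≡ _) (P≡ _) last }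
  where open Counters c

Counters-sum : ∀ {n D l u} {P Q : Fin n → ℕ → ℕ} → (∀ w → Counters D l u (P w) (Q w)) →
               Counters D l u (λ i → sum (λ w → P w i)) (λ i → sum (λ w → Q w i))
Counters-sum c = record
  { P-mono = λ i<D → sum-mono-≤ λ w → C.P-mono w i<D
  ; Q-mono = λ i<D → sum-mono-≤ λ w → C.Q-mono w i<D
  ; long   = λ i<D → sum-mono-≤ λ w → C.long w i<D
  ; short  = λ i<D → sum-mono-≤ λ w → C.short w i<D
  ; first  = sum-mono-≤ C.first
  ; last   = sum-mono-≤ C.last }
  where module C w = Counters (c w)

-- Uses that `minLength` is positive. Applied to a worker's work counters and off counters alike, it
-- keeps the number of open work periods at 0 or 1.
Q[1+i]≤P[i] : ∀ {D l u P Q} → Counters D l u P Q → ∀ {i} → i < D → Q (suc i) ≤ P i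
Q[1+i]≤P[i] {l = l} c {i} i<D =
  ≤-trans (long i<D) (mono-≤ P-mono (∸-monoʳ-≤ (suc i) (1≤minLength l)) (<⇒≤ i<D))
  where open Counters c

-- On every day S minus T is to be the number of workers ON. The shift by `N` makes T + N minus S
-- the number of workers OFF, so off periods obey the same kind of constraints with the roles
-- exchanged.
record System (N D lw uw lo uo : ℕ) (rl ru : Fin D → ℕ) (S T : ℕ → ℕ) : Set where
  field
    on       : Counters D lw uw S T
    off      : Counters D lo uo (λ i → T i + N) S
    staffing : ∀ d → T (suc (toℕ d)) + rl d ≤ S (suc (toℕ d)) ×
                     S (suc (toℕ d)) ≤ T (suc (toℕ d)) + ru d

-- Periods as stretches of a duty sequence

flip : Duty → Duty
flip ON  = OFF
flip OFF = ON

flip-≢ : ∀ x → flip x ≢ x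
flip-≢ ON  ()
flip-≢ OFF ()

-- With the opposite duty at index 0, the first day is always a change of duty, and a period
-- starting there is no special case. The default OFF beyond the last day makes the sequence total.
duty : ∀ {D} → (Fin D → Duty) → ℕ → Duty
day : ∀ {D} → (Fin D → Duty) → ℕ → Duty
day {D} g i with i <? D
... | yes i<D = g (fromℕ< i<D)
... | no  _   = OFF
duty g zero    = flip (day g 0)
duty g (suc i) = day g i

duty-suc : ∀ {D} (g : Fin D → Duty) d → duty g (suc (toℕ d)) ≡ g d
duty-suc {D} g d with toℕ d <? D
... | yes p = cong g (toℕ-injective (toℕ-fromℕ< p))
... | no  p = contradiction (toℕ<n d) p

record Stretch (D : ℕ) (G : ℕ → Duty) (x : Duty) (A B : ℕ) : Set where
  field
    1≤A    : 1 ≤ A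
    A≤B    : A ≤ B
    B≤D    : B ≤ D
    within : ∀ {i} → A ≤ i → i ≤ B → G i ≡ x
    before : G (pred A) ≢ x
    after  : B < D → G (suc B) ≢ x

module _ {N D : ℕ} (f : Schedule N D) (x : Duty) (w : Fin N) where

  private
    G : ℕ → Duty
    G = duty (f w)

  run-widenˡ : ∀ {a b c} → toℕ a ≡ suc (toℕ c) → Run f x w a b → f w c ≡ x → Run f x w c b
  run-widenˡ {a} {b} {c} a≡1+c (a≤b , r) fc = ≤-trans (≤-trans (n≤1+n _) (≤-reflexive (sym a≡1+c))) a≤b , r′
    where
    r′ : ∀ d → c Fin.≤ d → d Fin.≤ b → f w d ≡ x
    r′ d c≤d d≤b with toℕ c ≟ℕ toℕ d
    ... | yes c≡d = subst (λ d → f w d ≡ x) (toℕ-injective c≡d) fc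
    ... | no  c≢d = r d (≤-trans (≤-reflexive a≡1+c) (≤∧≢⇒< c≤d c≢d)) d≤b

  run-widenʳ : ∀ {a b c} → toℕ c ≡ suc (toℕ b) → Run f x w a b → f w c ≡ x → Run f x w a c
  run-widenʳ {a} {b} {c} c≡1+b (a≤b , r) fc = ≤-trans a≤b (≤-trans (n≤1+n _) (≤-reflexive (sym c≡1+b))) , r′
    where
    r′ : ∀ d → a Fin.≤ d → d Fin.≤ c → f w d ≡ x
    r′ d a≤d d≤c with toℕ d ≟ℕ toℕ c
    ... | yes d≡c = subst (λ d → f w d ≡ x) (sym (toℕ-injective d≡c)) fc
    ... | no  d≢c = r d a≤d (≤-pred (≤-trans (≤∧≢⇒< d≤c d≢c) (≤-reflexive c≡1+b)))

  period⇒stretch : ∀ {a b} → Period f x w a b → Stretch D G x (suc (toℕ a)) (suc (toℕ b))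
  period⇒stretch {a} {b} (run@(a≤b , r) , maximal) = record
    { 1≤A = s≤s z≤n ; A≤B = s≤s a≤b ; B≤D = toℕ<n b
    ; within = within ; before = before (toℕ a) refl ; after = after }
    where
    within : ∀ {i} → suc (toℕ a) ≤ i → i ≤ suc (toℕ b) → G i ≡ x
    within {suc i} (s≤s a≤i) (s≤s i≤b) =
      subst (λ i → G (suc i) ≡ x) (toℕ-fromℕ< i<D)
        (trans (duty-suc (f w) _) (r (fromℕ< i<D)
          (≤-trans a≤i (≤-reflexive (sym (toℕ-fromℕ< i<D))))
          (≤-trans (≤-reflexive (toℕ-fromℕ< i<D)) i≤b)))
      where
      i<D : i < D
      i<D = ≤-<-trans i≤b (toℕ<n b)

    before : ∀ k → toℕ a ≡ k → G k ≢ x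
    before zero a≡0 G0≡x = flip-≢ x (trans (cong flip (sym (within (s≤s (≤-reflexive a≡0)) (s≤s z≤n)))) G0≡x)
    before (suc k) a≡1+k Gk≡x =
      1+n≢n (trans (sym (trans a≡1+k (cong suc (sym c≡k)))) (cong toℕ (sym c≡a)))
      where
      k<D : k < D
      k<D = <-trans (≤-reflexive (sym a≡1+k)) (toℕ<n a)
      c : Fin D
      c = fromℕ< k<D
      c≡k : toℕ c ≡ k
      c≡k = toℕ-fromℕ< k<D
      c≡a : c ≡ a
      c≡a = proj₁ (maximal c b
        (≤-trans (≤-reflexive c≡k) (≤-trans (n≤1+n k) (≤-reflexive (sym a≡1+k)))) ≤-refl
        (run-widenˡ (trans a≡1+k (cong suc (sym c≡k))) run
          (trans (sym (duty-suc (f w) c)) (trans (cong (G ∘ suc) c≡k) Gk≡x))))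

    after : suc (toℕ b) < D → G (suc (suc (toℕ b))) ≢ x
    after b<D G≡x = 1+n≢n (trans (sym c≡1+b) (cong toℕ c≡b))
      where
      c : Fin D
      c = fromℕ< b<D
      c≡1+b : toℕ c ≡ suc (toℕ b)
      c≡1+b = toℕ-fromℕ< b<D
      c≡b : c ≡ b
      c≡b = proj₂ (maximal a c ≤-refl (≤-trans (n≤1+n _) (≤-reflexive (sym c≡1+b)))
        (run-widenʳ c≡1+b run (trans (sym (duty-suc (f w) c)) (trans (cong (G ∘ suc) c≡1+b) G≡x))))

  stretch⇒period : ∀ {A B} → Stretch D G x A B →
                   ∃₂ λ a b → Period f x w a b × A ≡ suc (toℕ a) × B ≡ suc (toℕ b)
  stretch⇒period {suc A} {suc B} s =
    a , b , ((a≤b , r) , maximal) , cong suc (sym a≡A) , cong suc (sym b≡B)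
    where
    open Stretch s
    a b : Fin D
    a = fromℕ< (≤-trans A≤B B≤D)
    b = fromℕ< B≤D
    a≡A : toℕ a ≡ A
    a≡A = toℕ-fromℕ< (≤-trans A≤B B≤D)
    b≡B : toℕ b ≡ B
    b≡B = toℕ-fromℕ< B≤D
    a≤b : a Fin.≤ b
    a≤b = subst₂ _≤_ (sym a≡A) (sym b≡B) (≤-pred A≤B)
    r : ∀ d → a Fin.≤ d → d Fin.≤ b → f w d ≡ x
    r d a≤d d≤b = trans (sym (duty-suc (f w) d))
      (within (s≤s (≤-trans (≤-reflexive (sym a≡A)) a≤d)) (s≤s (≤-trans d≤b (≤-reflexive b≡B))))
    maximal : ∀ a′ b′ → a′ Fin.≤ a → b Fin.≤ b′ → Run f x w a′ b′ → a′ ≡ a × b′ ≡ b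
    maximal a′ b′ a′≤a b≤b′ (_ , r′) =
      toℕ-injective (≤-antisym a′≤a (≮⇒≥ a′≮a)) , toℕ-injective (≤-antisym (≮⇒≥ b≮b′) b≤b′)
      where
      a′≮a : ¬ toℕ a′ < toℕ a
      a′≮a a′<a = contradiction before (go A (≤-trans a′<a (≤-reflexive a≡A)) a≡A)
        where
        go : ∀ A → toℕ a′ < A → toℕ a ≡ A → ¬ (G A ≢ x)
        go (suc k) (s≤s a′≤k) a≡1+k G≢x = G≢x (trans
          (trans (cong (G ∘ suc) (sym c≡k)) (duty-suc (f w) c))
          (r′ c (≤-trans a′≤k (≤-reflexive (sym c≡k)))
            (≤-trans (≤-reflexive c≡k) (≤-trans (≤-trans (n≤1+n k) (≤-reflexive (sym a≡1+k))) (≤-trans a≤b b≤b′)))))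
          where
          k<D : k < D
          k<D = <-trans (≤-reflexive (sym a≡1+k)) (toℕ<n a)
          c : Fin D
          c = fromℕ< k<D
          c≡k : toℕ c ≡ k
          c≡k = toℕ-fromℕ< k<D
      b≮b′ : ¬ toℕ b < toℕ b′
      b≮b′ b<b′ = after 1+B<D (trans (trans (cong (G ∘ suc) (sym c≡)) (duty-suc (f w) c))
        (r′ c (≤-trans (≤-trans a′≤a a≤b) (≤-trans (≤-reflexive b≡B) (≤-trans (n≤1+n B) (≤-reflexive (sym c≡)))))
          (≤-trans (≤-reflexive c≡) 1+B≤b′)))
        where
        1+B≤b′ : suc B ≤ toℕ b′
        1+B≤b′ = subst (λ k → suc k ≤ toℕ b′) b≡B b<b′
        1+B<D : suc B < D
        1+B<D = ≤-<-trans 1+B≤b′ (toℕ<n b′)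
        c : Fin D
        c = fromℕ< 1+B<D
        c≡ : toℕ c ≡ suc B
        c≡ = toℕ-fromℕ< 1+B<D

-- One period is open throughout a stretch, so `P` is constant on it. On a stretch longer than `u`,
-- `short` would close the period begun on its first day by its last day. On one shorter than
-- `minLength l`, the final value of `P` would be at most its value before the first day, although
-- `P` rises on that day.
stretch-lengths : ∀ {D l u P Q G x} → Counters D l u P Q →
                  (∀ {i} → i < D → P (suc i) ≤ suc (Q i)) →
                  (∀ {i} → i < D → G (suc i) ≡ x → Q (suc i) < P (suc i)) →
                  (∀ {i} → i < D → G (suc i) ≢ x → P (suc i) ≤ Q (suc i)) →
                  ∀ {A B} → Stretch D G x A B → l ≤ suc B ∸ A × suc B ∸ A ≤ u
stretch-lengths {D} {l} {u} {P} {Q} {G} {x} c P≤1+Q ∈x ∉x {suc A} {suc B} s =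
  ≤-trans (m≤m+n l _) (≮⇒≥ not-short) , ≮⇒≥ not-long
  where
  open Counters c
  open Stretch s
  constant : ∀ {i} → suc A ≤′ i → i ≤ suc B → P i ≤ P (suc A)
  constant ≤′-refl _ = ≤-refl
  constant {suc zero} (≤′-step (≤′-reflexive ()))
  constant {suc (suc i)} (≤′-step A≤i) i<B = ≤-trans
    (≤-trans (P≤1+Q (<-≤-trans i<B B≤D)) (∈x (<-trans (n<1+n i) (<-≤-trans i<B B≤D)) (within (≤′⇒≤ A≤i) (<⇒≤ i<B))))
    (constant A≤i (<⇒≤ i<B))

  P[B]≤P[A] : P (suc B) ≤ P (suc A)
  P[B]≤P[A] = constant (≤⇒≤′ A≤B) ≤-refl

  not-long : ¬ u < suc B ∸ A
  not-long u< = <⇒≱ (∈x B≤D (within A≤B ≤-refl))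
    (≤-trans P[B]≤P[A] (≤-trans (mono-≤ P-mono A<B∸u (≤-trans (m∸n≤m (suc B) u) B≤D)) (short B≤D)))
    where
    A<B∸u : suc A ≤ suc B ∸ u
    A<B∸u = m+n≤o⇒m≤o∸n (suc A) (subst₂ _≤_ (+-suc A u) (m+[n∸m]≡n (<⇒≤ A≤B)) (+-monoʳ-≤ A u<))

  -- A stretch reaching the last day is not followed by a day on which it counts as ended; there
  -- `last` takes the place of `long`.
  P[B]≤ : P (suc B) ≤ P (suc (suc B) ∸ minLength l)
  P[B]≤ with m≤n⇒m<n∨m≡n B≤D
  ... | inj₁ B<D = ≤-trans (P-mono B<D) (≤-trans (∉x B<D (after B<D)) (long B<D))
  ... | inj₂ B≡D = subst (λ B → P B ≤ P (suc B ∸ minLength l)) (sym B≡D) last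

  P[A-1]<P[A] : ∀ A → suc A ≤ D → G A ≢ x → G (suc A) ≡ x → P A < P (suc A)
  P[A-1]<P[A] zero    A<D G≢ G≡ = ≤-<-trans first (∈x A<D G≡)
  P[A-1]<P[A] (suc A) A<D G≢ G≡ = ≤-<-trans (∉x (<⇒≤ A<D) G≢) (≤-<-trans (Q-mono A<D) (∈x A<D G≡))

  not-short : ¬ suc B ∸ A < minLength l
  not-short <l = <⇒≱ (P[A-1]<P[A] A (≤-trans A≤B B≤D) before (within ≤-refl A≤B))
    (≤-trans (mono-≤ P-mono A≤B (B≤D))
      (≤-trans P[B]≤ (mono-≤ P-mono B∸l≤A (≤-trans (n≤1+n A) (≤-trans A≤B B≤D)))))
    where
    B∸l≤A : suc (suc B) ∸ minLength l ≤ A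
    B∸l≤A = m≤n+o⇒m∸o≤n {suc (suc B)} {A} (subst (_≤ A + minLength l) (cong suc (m+[n∸m]≡n (≤-trans (n≤1+n A) A≤B)))
      (subst (_≤ A + minLength l) (+-suc A _) (+-monoʳ-≤ A <l)))

-- Counters of a given duty sequence

module _ {D l u : ℕ} {P Q : ℕ → ℕ} {G : ℕ → Duty} {x : Duty}
  (1≤D     : 1 ≤ D)
  (∈x      : ∀ i → G i ≡ x → P i ≡ suc (Q i))
  (∉x      : ∀ i → G i ≢ x → P i ≡ Q i)
  (P-mono  : ∀ i → P i ≤ P (suc i))
  (Q-mono  : ∀ i → Q i ≤ Q (suc i))
  (P-stays : ∀ i → G i ≡ x ⊎ G (suc i) ≢ x → P (suc i) ≤ P i)
  (Q-stays : ∀ i → G i ≢ x ⊎ G (suc i) ≡ x → Q (suc i) ≤ Q i)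
  (G₀≢G₁   : G 0 ≢ G 1)
  (lengths : ∀ {A B} → Stretch D G x A B → l ≤ suc B ∸ A × suc B ∸ A ≤ u)
  where

  private
    beginning : ∀ i → G (suc i) ≡ x →
                ∃ λ A → suc A ≤ suc i × (∀ {j} → suc A ≤ j → j ≤ suc i → G j ≡ x) × G A ≢ x
    beginning zero G≡x = 0 , ≤-refl ,
      (λ 1≤j j≤1 → subst (λ j → G j ≡ x) (≤-antisym 1≤j j≤1) G≡x) ,
      λ G0≡x → G₀≢G₁ (trans G0≡x (sym G≡x))
    beginning (suc i) G≡x with G (suc i) ≟ x
    ... | no G≢x = suc i , ≤-refl ,
      (λ 1≤j j≤1 → subst (λ j → G j ≡ x) (≤-antisym 1≤j j≤1) G≡x) , G≢x
    ... | yes G≡x′ with beginning i G≡x′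
    ...   | A , A≤i , r , G≢x = A , ≤-trans A≤i (n≤1+n _) , r′ , G≢x
      where
      r′ : ∀ {j} → suc A ≤ j → j ≤ suc (suc i) → G j ≡ x
      r′ A<j j≤ with m≤n⇒m<n∨m≡n j≤
      ... | inj₁ (s≤s j≤i) = r A<j j≤i
      ... | inj₂ j≡        = subst (λ j → G j ≡ x) (sym j≡) G≡x

    ending : ∀ k i → i + k ≡ D → G i ≡ x →
             ∃ λ B → i ≤ B × B ≤ D × (∀ {j} → i ≤ j → j ≤ B → G j ≡ x) × (B < D → G (suc B) ≢ x)
    ending zero i eq G≡x = i , ≤-refl , ≤-reflexive i≡D ,
      (λ i≤j j≤i → subst (λ j → G j ≡ x) (≤-antisym i≤j j≤i) G≡x) ,
      λ i<D → contradiction i≡D (<⇒≢ i<D)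
      where
      i≡D : i ≡ D
      i≡D = trans (sym (+-identityʳ i)) eq
    ending (suc k) i eq G≡x with G (suc i) ≟ x
    ... | no G≢x = i , ≤-refl , m+n≤o⇒m≤o i (≤-reflexive eq) ,
      (λ i≤j j≤i → subst (λ j → G j ≡ x) (≤-antisym i≤j j≤i) G≡x) , λ _ → G≢x
    ... | yes G≡x′ with ending k (suc i) (trans (sym (+-suc i k)) eq) G≡x′
    ...   | B , i<B , B≤D , r , G≢x = B , <⇒≤ i<B , B≤D , r′ , G≢x
      where
      r′ : ∀ {j} → i ≤ j → j ≤ B → G j ≡ x
      r′ i≤j j≤B with m≤n⇒m<n∨m≡n i≤j
      ... | inj₁ i<j = r i<j j≤B
      ... | inj₂ i≡j = subst (λ j → G j ≡ x) i≡j G≡x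

    surrounding : ∀ {i} → i < D → G (suc i) ≡ x →
                  ∃₂ λ A B → Stretch D G x (suc A) B × suc A ≤ suc i × suc i ≤ B
    surrounding {i} i<D G≡x with beginning i G≡x | ending (D ∸ suc i) (suc i) (m+[n∸m]≡n i<D) G≡x
    ... | A , A≤i , r , G≢x | B , i≤B , B≤D , r′ , G≢x′ = A , B , record
      { 1≤A = s≤s z≤n ; A≤B = ≤-trans A≤i i≤B ; B≤D = B≤D ; within = within
      ; before = G≢x ; after = G≢x′ } , A≤i , i≤B
      where
      within : ∀ {j} → suc A ≤ j → j ≤ B → G j ≡ x
      within {j} A<j j≤B with ≤-total j (suc i)
      ... | inj₁ j≤i = r A<j j≤i
      ... | inj₂ i≤j = r′ i≤j j≤B

    P-≤ : ∀ {i j} → i ≤ j → P i ≤ P j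
    P-≤ i≤j = mono-≤ (λ {i} _ → P-mono i) i≤j ≤-refl

    Q-≤ : ∀ {i j} → i ≤ j → Q i ≤ Q j
    Q-≤ i≤j = mono-≤ (λ {i} _ → Q-mono i) i≤j ≤-refl

    constant : ∀ {A B} → A ≤′ B → (∀ {j} → A ≤ j → j ≤ B → G j ≡ x) → P B ≤ P A
    constant ≤′-refl       r = ≤-refl
    constant (≤′-step A≤B) r = ≤-trans (P-stays _ (inj₁ (r (≤′⇒≤ A≤B) (n≤1+n _))))
      (constant A≤B (λ A≤j j≤B → r A≤j (≤-trans j≤B (n≤1+n _))))

    finished : ∀ {A B} → Stretch D G x A B → P B ≤ P (suc B ∸ minLength l)
    finished {A} {B} s = ≤-trans (constant (≤⇒≤′ A≤B) within) (P-≤ (m+n≤o⇒m≤o∸n A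
      (≤-trans (+-monoʳ-≤ A (minLength-≤ (proj₁ (lengths s))))
        (≤-reflexive (m+[n∸m]≡n (≤-trans A≤B (n≤1+n B)))))))
      where
      open Stretch s
      minLength-≤ : ∀ {l} → l ≤ suc B ∸ A → minLength l ≤ suc B ∸ A
      minLength-≤ {zero}  _ = m<n⇒0<n∸m (s≤s A≤B)
      minLength-≤ {suc l} h = subst (_≤ suc B ∸ A)
        (sym (trans (cong (suc l +_) (0∸n≡0 l)) (+-identityʳ _))) h

    short : ∀ {i} → i < D → P (suc i ∸ u) ≤ Q (suc i)
    short {i} i<D with G (suc i) ≟ x
    ... | no G≢x = ≤-trans (P-≤ (m∸n≤m (suc i) u)) (≤-reflexive (∉x _ G≢x))
    ... | yes G≡x with surrounding i<D G≡x
    ...   | A , B , s , A≤i , i≤B = ≤-trans (P-≤ i∸u≤A)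
      (≤-trans (≤-reflexive (∉x A (Stretch.before s))) (Q-≤ (≤-trans (n≤1+n A) A≤i)))
      where
      i∸u≤A : suc i ∸ u ≤ A
      i∸u≤A = m≤n+o⇒m∸o≤n {suc i} {A} (≤-trans i≤B (≤-trans
        (≤-reflexive (sym (m+[n∸m]≡n (≤-trans (≤-trans (n≤1+n A) A≤i) i≤B))))
        (+-monoʳ-≤ A (proj₂ (lengths s)))))

    -- `Q` grows only on leaving a stretch. That stretch then lies complete in the past, has at
    -- least `minLength l` days, and `P` has not changed since its first day.
    long : ∀ i → i ≤ D → Q i ≤ P (i ∸ minLength l)
    long zero _ = ≤-trans (lemma (G 0 ≟ x)) (P-≤ z≤n)
      where
      lemma : Dec (G 0 ≡ x) → Q 0 ≤ P 0
      lemma (yes p) = ≤-trans (n≤1+n _) (≤-reflexive (sym (∈x 0 p)))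
      lemma (no  p) = ≤-reflexive (sym (∉x 0 p))
    long (suc i) i<D with G i ≟ x | G (suc i) ≟ x
    ... | no G≢x | _ = ≤-trans (Q-stays i (inj₁ G≢x))
      (≤-trans (long i (<⇒≤ i<D)) (P-≤ (∸-monoˡ-≤ (minLength l) (n≤1+n i))))
    ... | yes _ | yes G≡x = ≤-trans (Q-stays i (inj₂ G≡x))
      (≤-trans (long i (<⇒≤ i<D)) (P-≤ (∸-monoˡ-≤ (minLength l) (n≤1+n i))))
    ... | yes G≡x | no G≢x = ≤-trans (≤-reflexive (sym (∉x (suc i) G≢x)))
      (≤-trans (P-stays i (inj₁ G≡x)) (ended i i<D G≡x G≢x))
      where
      ended : ∀ i → i < D → G i ≡ x → G (suc i) ≢ x → P i ≤ P (suc i ∸ minLength l)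
      -- The fictitious period at index 0 is exempt from the lower bound, because the shifted index
      -- is truncated to 0.
      ended zero    _   _   _   = P-≤ z≤n
      ended (suc i) i<D G≡x G≢x with beginning i G≡x
      ... | A , A≤i , r , G≢x′ = finished record
        { 1≤A = s≤s z≤n ; A≤B = A≤i ; B≤D = <⇒≤ i<D ; within = r
        ; before = G≢x′ ; after = λ _ → G≢x }

    last : P D ≤ P (suc D ∸ minLength l)
    last = go D refl 1≤D
      where
      go : ∀ B → B ≡ D → 1 ≤ B → P B ≤ P (suc B ∸ minLength l)
      go (suc B) B≡D _ with G (suc B) ≟ x
      ... | no G≢x = ≤-trans (≤-reflexive (∉x _ G≢x))
        (≤-trans (long (suc B) (≤-reflexive B≡D)) (P-≤ (∸-monoˡ-≤ (minLength l) (n≤1+n (suc B)))))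
      ... | yes G≡x with beginning B G≡x
      ...   | A , A≤B , r , G≢x = finished record
        { 1≤A = s≤s z≤n ; A≤B = A≤B ; B≤D = ≤-reflexive B≡D ; within = r
        ; before = G≢x ; after = λ B<D → contradiction B≡D (<⇒≢ B<D) }

    first : P 0 ≤ Q 1
    first with G 0 ≟ x
    ... | no  G₀≢x = ≤-trans (≤-reflexive (∉x 0 G₀≢x)) (Q-mono 0)
    ... | yes G₀≡x = ≤-trans (P-mono 0) (≤-reflexive (∉x 1 λ G₁≡x → G₀≢G₁ (trans G₀≡x (sym G₁≡x))))

  stretch-counters : Counters D l u P Q
  stretch-counters = record
    { P-mono = λ {i} _ → P-mono i ; Q-mono = λ {i} _ → Q-mono i
    ; long = λ {i} → long (suc i) ; short = short ; first = first ; last = last }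

indicator : Duty → ℕ
indicator ON  = 1
indicator OFF = 0

starting ending : Duty → Duty → ℕ
starting OFF ON = 1
starting _   _  = 0
ending ON OFF = 1
ending _  _   = 0

-- A worker ON at index 0 is credited with a fictitious work period, so that `starts` minus `ends`
-- indicates duty ON from index 0 onwards.
starts ends : (ℕ → Duty) → ℕ → ℕ
starts G zero    = indicator (G 0)
starts G (suc i) = starts G i + starting (G i) (G (suc i))
ends G zero    = 0
ends G (suc i) = ends G i + ending (G i) (G (suc i))

starts≡ends+indicator : ∀ G i → starts G i ≡ ends G i + indicator (G i)
starts≡ends+indicator G zero = refl
starts≡ends+indicator G (suc i) = trans (cong (_+ starting (G i) (G (suc i))) (starts≡ends+indicator G i))
  (trans (+-assoc (ends G i) _ _) (trans (cong (ends G i +_) (lemma (G i) (G (suc i)))) (sym (+-assoc (ends G i) _ _))))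
  where
  lemma : ∀ p q → indicator p + starting p q ≡ ending p q + indicator q
  lemma ON  ON  = refl
  lemma ON  OFF = refl
  lemma OFF ON  = refl
  lemma OFF OFF = refl

on-counters : ∀ {D l u G} → 1 ≤ D → G 0 ≢ G 1 →
              (∀ {A B} → Stretch D G ON A B → l ≤ suc B ∸ A × suc B ∸ A ≤ u) →
              Counters D l u (starts G) (ends G)
on-counters {D} {G = G} 1≤D G₀≢G₁ = stretch-counters 1≤D
  (λ i eq → trans (balance i) (trans (cong (λ p → ends G i + indicator p) eq) (+-comm _ 1)))
  (λ i ne → trans (balance i) (trans (cong (ends G i +_) (OFF-0 (G i) ne)) (+-identityʳ _)))
  (λ i → m≤m+n _ _) (λ i → m≤m+n _ _)
  (λ i h → ≤-reflexive (trans (cong (starts G i +_) (no-start (G i) (G (suc i)) h)) (+-identityʳ _)))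
  (λ i h → ≤-reflexive (trans (cong (ends G i +_) (no-end (G i) (G (suc i)) h)) (+-identityʳ _)))
  G₀≢G₁
  where
  balance : ∀ i → starts G i ≡ ends G i + indicator (G i)
  balance = starts≡ends+indicator G
  OFF-0 : ∀ p → p ≢ ON → indicator p ≡ 0
  OFF-0 ON  ne = contradiction refl ne
  OFF-0 OFF ne = refl
  no-start : ∀ p q → p ≡ ON ⊎ q ≢ ON → starting p q ≡ 0
  no-start ON  q   _         = refl
  no-start OFF OFF _         = refl
  no-start OFF ON  (inj₂ ne) = contradiction refl ne
  no-end : ∀ p q → p ≢ ON ⊎ q ≡ ON → ending p q ≡ 0
  no-end ON  ON  _         = refl
  no-end OFF q   _         = refl
  no-end ON  OFF (inj₁ ne) = contradiction refl ne

-- The added 1 makes `ends G i + 1` minus `starts G i` the indicator of duty OFF; summed over the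
-- workers it becomes the `N` of the system.
off-counters : ∀ {D l u G} → 1 ≤ D → G 0 ≢ G 1 →
               (∀ {A B} → Stretch D G OFF A B → l ≤ suc B ∸ A × suc B ∸ A ≤ u) →
               Counters D l u (λ i → ends G i + 1) (starts G)
off-counters {D} {G = G} 1≤D G₀≢G₁ = stretch-counters 1≤D
  (λ i eq → trans (+-comm _ 1) (cong suc (sym (trans (balance i)
    (trans (cong (λ p → ends G i + indicator p) eq) (+-identityʳ _))))))
  (λ i ne → trans (cong (ends G i +_) (sym (ON-1 (G i) ne))) (sym (balance i)))
  (λ i → +-monoˡ-≤ 1 (m≤m+n _ _)) (λ i → m≤m+n _ _)
  (λ i h → +-monoˡ-≤ 1 (≤-reflexive (trans (cong (ends G i +_) (no-end (G i) (G (suc i)) h)) (+-identityʳ _))))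
  (λ i h → ≤-reflexive (trans (cong (starts G i +_) (no-start (G i) (G (suc i)) h)) (+-identityʳ _)))
  G₀≢G₁
  where
  balance : ∀ i → starts G i ≡ ends G i + indicator (G i)
  balance = starts≡ends+indicator G
  ON-1 : ∀ p → p ≢ OFF → indicator p ≡ 1
  ON-1 OFF ne = contradiction refl ne
  ON-1 ON  ne = refl
  no-start : ∀ p q → p ≢ OFF ⊎ q ≡ OFF → starting p q ≡ 0
  no-start ON  q   _         = refl
  no-start OFF OFF _         = refl
  no-start OFF ON  (inj₁ ne) = contradiction refl ne
  no-end : ∀ p q → p ≡ OFF ⊎ q ≢ OFF → ending p q ≡ 0
  no-end ON  ON  _         = refl
  no-end OFF q   _         = refl
  no-end ON  OFF (inj₂ ne) = contradiction refl ne

count-allFin : ∀ {n} (g : Fin n → Duty) → count (λ w → g w ≟ ON) (allFin n) ≡ sum (λ w → indicator (g w))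
count-allFin {n} g = go n id
  where
  go : ∀ m (h : Fin m → Fin n) → count (λ w → g w ≟ ON) (Vec.tabulate h) ≡ sum (λ w → indicator (g (h w)))
  go zero    h = refl
  go (suc m) h with g (h Fin.zero)
  ... | ON  = cong suc (go m (h ∘ Fin.suc))
  ... | OFF = go m (h ∘ Fin.suc)

-- Feasible schedules correspond to solutions of the system

module _ (I : Instance) (local : IsLocal I) where
  open Instance I

  private
    instance
      N≢0 : NonZero N
      N≢0 = >-nonZero 1≤N

  Solution : (S T : ℕ → ℕ) → Set
  Solution = System N D lw uw lo uo rl ru

  solution⇒feasible : ∀ {S T} → Solution S T → DODOSP I
  solution⇒feasible {S} {T} sys = f , record
    { staffing = λ d → let T+rl≤S , S≤T+ru = staffing d in
        +-cancelˡ-≤ (T (suc (toℕ d))) _ _ (subst (_ ≤_) (balance d) T+rl≤S) ,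
        +-cancelˡ-≤ (T (suc (toℕ d))) _ _ (subst (_≤ _) (balance d) S≤T+ru)
    ; work = λ w a b → lengths-on w ∘ period⇒stretch f ON w
    ; off = λ w a b → lengths-off w ∘ period⇒stretch f OFF w
    -- By locality both caps equal `D`, and a worker has only `D` days.
    ; totalOn = λ w → subst (daysWith f ON w ≤_) (sym (proj₁ local)) (count≤n (λ d → f w d ≟ ON) (allFin D))
    ; totalOff = λ w → subst (daysWith f OFF w ≤_) (sym (proj₂ local)) (count≤n (λ d → f w d ≟ OFF) (allFin D))
    }
    where
    open System sys

    share : Fin N → ℕ → ℕ
    share w n = (n + toℕ w) / N

    share-mono : ∀ w {m n} → m ≤ n → share w m ≤ share w n
    share-mono w m≤n = /-monoˡ-≤ N (+-monoˡ-≤ (toℕ w) m≤n)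

    -- Turns the `N` of the off constraints, which stands for all workers, into the 1 of a single
    -- worker.
    share-+N : ∀ w n → share w (n + N) ≡ share w n + 1
    share-+N w n = trans (cong (_/ N) (trans (+-assoc n N _) (trans (cong (n +_) (+-comm N _)) (sym (+-assoc n _ N)))))
      ([m+n]/n (n + toℕ w) N)

    P Q : Fin N → ℕ → ℕ
    P w i = share w (S i)
    Q w i = share w (T i)

    on-w : ∀ w → Counters D lw uw (P w) (Q w)
    on-w w = Counters-map (share-mono w) on

    off-w : ∀ w → Counters D lo uo (λ i → Q w i + 1) (P w)
    off-w w = Counters-cong (λ i → share-+N w (T i)) (Counters-map (share-mono w) off)

    dutyAt : ℕ → ℕ → Duty
    dutyAt p q = if q <ᵇ p then ON else OFF

    f : Schedule N D
    f w d = dutyAt (P w (suc (toℕ d))) (Q w (suc (toℕ d)))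

    f-suc : ∀ w {i} → i < D → duty (f w) (suc i) ≡ dutyAt (P w (suc i)) (Q w (suc i))
    f-suc w {i} i<D = subst (λ i → duty (f w) (suc i) ≡ dutyAt (P w (suc i)) (Q w (suc i)))
      (toℕ-fromℕ< i<D) (duty-suc (f w) (fromℕ< i<D))

    P≤1+Q : ∀ w {i} → i < D → P w (suc i) ≤ suc (Q w i)
    P≤1+Q w {i} i<D = ≤-trans (Q[1+i]≤P[i] (off-w w) i<D) (≤-reflexive (+-comm _ 1))

    Q≤P : ∀ w {i} → i < D → Q w (suc i) ≤ P w (suc i)
    Q≤P w i<D = ≤-trans (Q[1+i]≤P[i] (on-w w) i<D) (Counters.P-mono (on-w w) i<D)

    ON⇒< : ∀ {p q} → dutyAt p q ≡ ON → q < p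
    ON⇒< {p} {q} eq with q <ᵇ p in lt
    ... | true = <ᵇ⇒< q p (subst IsTrue (sym lt) _)
    ON⇒< () | false

    ≢ON⇒≥ : ∀ {p q} → dutyAt p q ≢ ON → p ≤ q
    ≢ON⇒≥ {p} {q} ne with q <ᵇ p in lt
    ... | true  = contradiction refl ne
    ... | false = ≮⇒≥ λ q<p → subst IsTrue lt (<⇒<ᵇ q<p)

    lengths-on : ∀ w {A B} → Stretch D (duty (f w)) ON A B → lw ≤ suc B ∸ A × suc B ∸ A ≤ uw
    lengths-on w = stretch-lengths (on-w w) (P≤1+Q w)
      (λ i<D eq → ON⇒< (trans (sym (f-suc w i<D)) eq))
      (λ i<D ne → ≢ON⇒≥ (ne ∘ trans (f-suc w i<D)))

    lengths-off : ∀ w {A B} → Stretch D (duty (f w)) OFF A B → lo ≤ suc B ∸ A × suc B ∸ A ≤ uo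
    lengths-off w = stretch-lengths (off-w w)
      (λ {i} i<D → ≤-trans (≤-reflexive (+-comm _ 1)) (s≤s (Q[1+i]≤P[i] (on-w w) i<D)))
      (λ i<D eq → ≤-trans (s≤s (≢ON⇒≥ λ eq′ → contradiction
          (trans (sym eq) (trans (f-suc w i<D) eq′)) λ ())) (≤-reflexive (+-comm 1 _)))
      (λ i<D ne → ≤-trans (≤-reflexive (+-comm _ 1)) (ON⇒< (trans (sym (f-suc w i<D)) (≢OFF ne))))
      where
      ≢OFF : ∀ {p} → p ≢ OFF → p ≡ ON
      ≢OFF {ON}  ne = refl
      ≢OFF {OFF} ne = contradiction refl ne

    dutyAt-indicator : ∀ {p q} → q ≤ p → p ≤ q + 1 → p ≡ q + indicator (dutyAt p q)
    dutyAt-indicator {p} {q} q≤p p≤q+1 with q <ᵇ p in lt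
    ... | true  = ≤-antisym p≤q+1 (≤-trans (≤-reflexive (+-comm q 1)) (<ᵇ⇒< q p (subst IsTrue (sym lt) _)))
    ... | false = trans (≤-antisym (≮⇒≥ λ q<p → subst IsTrue lt (<⇒<ᵇ q<p)) q≤p) (sym (+-identityʳ q))

    balance : ∀ d → S (suc (toℕ d)) ≡ T (suc (toℕ d)) + workersOn f d
    balance d = begin
      S i                                                ≡⟨ sym (hermite-identity N (S i)) ⟩
      sum (λ w → P w i)                                  ≡⟨ sum-cong-≗ {N} (λ w → dutyAt-indicator (Q≤P w (toℕ<n d))
                                                              (≤-trans (P≤1+Q w (toℕ<n d)) (≤-trans (s≤s (Counters.Q-mono (on-w w) (toℕ<n d))) (≤-reflexive (+-comm 1 _))))) ⟩
      sum (λ w → Q w i + indicator (f w d))              ≡⟨ ∑-distrib-+ (λ w → Q w i) (λ w → indicator (f w d)) ⟩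
      sum (λ w → Q w i) + sum (λ w → indicator (f w d))  ≡⟨ cong₂ _+_ (hermite-identity N (T i)) (sym (count-allFin (λ w → f w d))) ⟩
      T i + workersOn f d                                ∎
      where
      open ≡-Reasoning
      i : ℕ
      i = suc (toℕ d)

  feasible⇒solution : DODOSP I → ∃₂ Solution
  feasible⇒solution (f , feasible) = S , T , record
    { on = Counters-sum λ w → on-counters 1≤D (G₀≢G₁ w) (lengths work w)
    ; off = Counters-cong (λ i → sum-suc (λ w → ends (G w) i))
        (Counters-sum λ w → off-counters 1≤D (G₀≢G₁ w) (lengths off w))
    ; staffing = λ d → let rl≤ , ≤ru = staffing d in
        subst (T (suc (toℕ d)) + rl d ≤_) (sym (balance d)) (+-monoʳ-≤ (T (suc (toℕ d))) rl≤) ,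
        subst (_≤ T (suc (toℕ d)) + ru d) (sym (balance d)) (+-monoʳ-≤ (T (suc (toℕ d))) ≤ru)
    }
    where
    open Feasible feasible

    G : Fin N → ℕ → Duty
    G w = duty (f w)

    S T : ℕ → ℕ
    S i = sum (λ w → starts (G w) i)
    T i = sum (λ w → ends (G w) i)

    G₀≢G₁ : ∀ w → G w 0 ≢ G w 1
    G₀≢G₁ w = flip-≢ (G w 1)

    lengths : ∀ {x l u} →
              (∀ w a b → Period f x w a b → l ≤ periodLength a b × periodLength a b ≤ u) →
              ∀ w {A B} → Stretch D (G w) x A B → l ≤ suc B ∸ A × suc B ∸ A ≤ u
    lengths {x} periods w s with stretch⇒period f x w s
    ... | a , b , period , refl , refl = periods w a b period

    balance : ∀ d → S (suc (toℕ d)) ≡ T (suc (toℕ d)) + workersOn f d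
    balance d = begin
      S i                                        ≡⟨ sum-cong-≗ {N} (λ w → starts≡ends+indicator (G w) i) ⟩
      sum (λ w → ends (G w) i + indicator (G w i))
        ≡⟨ ∑-distrib-+ (λ w → ends (G w) i) (λ w → indicator (G w i)) ⟩
      T i + sum (λ w → indicator (G w i))
        ≡⟨ cong (T i +_) (trans (sum-cong-≗ {N} (λ w → cong indicator (duty-suc (f w) d)))
             (sym (count-allFin (λ w → f w d)))) ⟩
      T i + workersOn f d                        ∎
      where
      open ≡-Reasoning
      i : ℕ
      i = suc (toℕ d)

-- Random access machines

State : Set
State = (Reg → ℕ) × (ℕ → ℕ)

at : Label → State → Config
at l (R , M) = ⟨ l , R , M ⟩

straight : Instr → Bool
straight (jump _) = false
straight (jz _ _) = false
straight (halt _) = false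
straight _        = true

effect : Instr → State → State
effect (const r k) (R , M) = R [ r ↦ k ] , M
effect (add r s t) (R , M) = R [ r ↦ R s + R t ] , M
effect (sub r s t) (R , M) = R [ r ↦ R s ∸ R t ] , M
effect (load r s)  (R , M) = R [ r ↦ M (R s) ] , M
effect (store r s) (R , M) = R , M [ R r ↦ R s ]
effect _           σ       = σ

-- Boolean, so that for a concrete block the condition computes to the unit type and `_` proves it.
allStraight : List Instr → Bool
allStraight []       = true
allStraight (i ∷ is) = straight i ∧ allStraight is

run : List Instr → State → State
run []       σ = σ
run (i ∷ is) σ = run is (effect i σ)

run-++ : ∀ is js σ → run (is ++ js) σ ≡ run js (run is σ)
run-++ []       js σ = refl
run-++ (i ∷ is) js σ = run-++ is js (effect i σ)

exec-straight : ∀ i → IsTrue (straight i) → ∀ l σ → exec i (at l σ) ≡ inj₁ (at (suc l) (effect i σ))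
exec-straight (const _ _) _ l σ = refl
exec-straight (add _ _ _) _ l σ = refl
exec-straight (sub _ _ _) _ l σ = refl
exec-straight (load _ _)  _ l σ = refl
exec-straight (store _ _) _ l σ = refl

infix 4 _⊢_⟶[_]_
-- Reachability is expressed by its effect on halting runs: every halting run from `σ′` extends
-- backwards by `n` steps. Concatenation is then composition of functions.
record _⊢_⟶[_]_ (p : Program) (σ : Config) (n : ℕ) (σ′ : Config) : Set where
  constructor steps
  field
    resume : ∀ {t b} → p ⊢ σ′ ⇓[ t ] b → p ⊢ σ ⇓[ n + t ] b

open _⊢_⟶[_]_

⟶-trans : ∀ {p σ₁ σ₂ σ₃ m n} → p ⊢ σ₁ ⟶[ m ] σ₂ → p ⊢ σ₂ ⟶[ n ] σ₃ → p ⊢ σ₁ ⟶[ m + n ] σ₃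
⟶-trans {p} {σ₁} {m = m} {n} r s = steps λ {t} {b} e →
  subst (λ k → p ⊢ σ₁ ⇓[ k ] b) (sym (+-assoc m n t)) (resume r (resume s e))

fetch-drop : ∀ p o {i is} → drop o p ≡ i ∷ is → fetch p o ≡ i
fetch-drop (_ ∷ _) zero    refl = refl
fetch-drop (_ ∷ p) (suc o) eq   = fetch-drop p o eq

drop-suc : ∀ (p : Program) o {i is} → drop o p ≡ i ∷ is → drop (suc o) p ≡ is
drop-suc (_ ∷ _) zero    refl = refl
drop-suc (_ ∷ p) (suc o) eq   = drop-suc p o eq

⟶-step : ∀ p l {i is σ σ′} → drop l p ≡ i ∷ is → exec i (at l σ) ≡ inj₁ σ′ → p ⊢ at l σ ⟶[ 1 ] σ′
⟶-step p l {σ = σ} at-l eq = steps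
  (next (trans (cong (λ i → exec i (at l σ)) (fetch-drop p l at-l)) eq))

⟶-block : ∀ p l is {js} σ → drop l p ≡ is ++ js → IsTrue (allStraight is) →
          p ⊢ at l σ ⟶[ length is ] at (l + length is) (run is σ)
⟶-block p l []       σ at-l _  = steps λ {t} {b} → subst (λ l → p ⊢ at l σ ⇓[ t ] b) (+-identityʳ l)
⟶-block p l (i ∷ is) σ at-l ok = ⟶-trans (⟶-step p l {σ = σ} at-l (exec-straight i (proj₁ oks) l σ))
  (subst (λ k → p ⊢ at (suc l) (effect i σ) ⟶[ length is ] at k (run is (effect i σ))) (sym (+-suc l (length is)))
    (⟶-block p (suc l) is (effect i σ) (drop-suc p l at-l) (proj₂ oks)))
  where
  split : ∀ x {y} → IsTrue (x ∧ y) → IsTrue x × IsTrue y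
  split true ok = _ , ok
  oks : IsTrue (straight i) × IsTrue (allStraight is)
  oks = split (straight i) ok

⟶-jz-0 : ∀ p l {r k is R M} → drop l p ≡ jz r k ∷ is → R r ≡ 0 →
         p ⊢ ⟨ l , R , M ⟩ ⟶[ 1 ] ⟨ k , R , M ⟩
⟶-jz-0 p l {k = k} {R = R} {M} at-l eq =
  ⟶-step p l {σ = R , M} at-l (cong (λ v → inj₁ ⟨ (if v ≡ᵇ 0 then k else suc l) , R , M ⟩) eq)

⟶-jz-suc : ∀ p l {r k is R M n} → drop l p ≡ jz r k ∷ is → R r ≡ suc n →
           p ⊢ ⟨ l , R , M ⟩ ⟶[ 1 ] ⟨ suc l , R , M ⟩
⟶-jz-suc p l {k = k} {R = R} {M} at-l eq =
  ⟶-step p l {σ = R , M} at-l (cong (λ v → inj₁ ⟨ (if v ≡ᵇ 0 then k else suc l) , R , M ⟩) eq)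

-- The program

-- Registers 0 to 3 are scratch and 4 accumulates the excess of a round.  Register 5 + k is k-th
-- in the environment: 5 to 8 are the loop variables, the others are fixed by the initialisation.
`excess `index `rl `ru `rounds `0 `1 `D `N `lw `uw `lo `uo `S `T `rl₀ `ru₀ : Reg
`excess = 4
`index  = 5
`rl     = 6
`ru     = 7
`rounds = 8
`0      = 9
`1      = 10
`D      = 11
`N      = 12
`lw     = 13
`uw     = 14
`lo     = 15
`uo     = 16
`S      = 17
`T      = 18
`rl₀    = 19
`ru₀    = 20

-- The registers of an edge, each given as k for 5 + k.  With index i, the edge leads from
-- entry i ∸ srcShift of the array at src to entry i ∸ tgtShift of the array at tgt.
record EdgeCode : Set where
  constructor edgeCode
  field
    tgt tgtShift src srcShift pos neg : ℕ

compile : EdgeCode → List Instr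
compile (edgeCode t t′ s s′ p q) =
  sub 0 `index (5 + t′) ∷ add 0 0 (5 + t) ∷
  sub 1 `index (5 + s′) ∷ add 1 1 (5 + s) ∷
  load 2 1 ∷ add 2 2 (5 + p) ∷ sub 2 2 (5 + q) ∷
  load 3 0 ∷ sub 2 2 3 ∷
  add `excess `excess 2 ∷ add 3 3 2 ∷ store 0 3 ∷ []

meaning : (ℕ → ℕ) → EdgeCode → Edge
meaning ρ (edgeCode t t′ s s′ p q) = edge (ρ 0 ∸ ρ t′ + ρ t) (ρ 0 ∸ ρ s′ + ρ s) (ρ p) (ρ q)

environment : (Reg → ℕ) → (ℕ → ℕ)
environment R k = R (5 + k)

meaning-cong : ∀ {ρ ρ′} → (∀ k → ρ k ≡ ρ′ k) → ∀ es → map (meaning ρ) es ≡ map (meaning ρ′) es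
meaning-cong ρ≡ [] = refl
meaning-cong ρ≡ (edgeCode t t′ s s′ p q ∷ es)
  rewrite ρ≡ 0 | ρ≡ t | ρ≡ t′ | ρ≡ s | ρ≡ s′ | ρ≡ p | ρ≡ q = cong (_ ∷_) (meaning-cong ρ≡ es)

compileAll : List EdgeCode → List Instr
compileAll []       = []
compileAll (e ∷ es) = compile e ++ compileAll es

-- Scratch registers and `excess` lie below 5, those of the environment have the form `5 + k`. Hence
-- the twelve instructions of an edge evaluate, even for a variable edge, to one `relax`, its
-- `excess` and an unchanged environment.
run-compileAll : ∀ es R M → let R′ , M′ = run (compileAll es) (R , M)
                                es′     = map (meaning (environment R)) es in
                 M′ ≡ relaxAll M es′ ×
                 R′ `excess ≡ R `excess + totalExcess M es′ ×
                 (∀ k → environment R′ k ≡ environment R k)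
run-compileAll []       R M = refl , sym (+-identityʳ _) , λ _ → refl
run-compileAll (e@(edgeCode _ _ _ _ _ _) ∷ es) R M
  with run-compileAll es (proj₁ (run (compile e) (R , M))) (proj₂ (run (compile e) (R , M)))
... | M≡ , excess≡ , env≡ = M≡ , trans excess≡ (+-assoc (R `excess) _ _) , env≡

-- The bases 7 and 7 + D lie one cell before the arrays of bounds, since days have indices from 1.
-- The arrays `S` and `T`, of D + 1 cells each, follow the input. Every cell up to the end of `T` is
-- a vertex; `rounds` is the number of these cells plus one round for the test.
initialise : List Instr
initialise =
  const `1 1 ∷
  load `D `0 ∷ load `N `1 ∷
  const 0 2 ∷ load `lw 0 ∷ const 0 3 ∷ load `uw 0 ∷
  const 0 4 ∷ load `lo 0 ∷ const 0 5 ∷ load `uo 0 ∷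
  sub 0 `1 `lw ∷ add `lw `lw 0 ∷
  sub 0 `1 `lo ∷ add `lo `lo 0 ∷
  const `rl₀ 7 ∷ add `ru₀ `rl₀ `D ∷
  add `S `ru₀ `D ∷ add `S `1 `S ∷
  add `T `S `D ∷ add `T `1 `T ∷
  add `rounds `T `D ∷ add `rounds `1 `rounds ∷ add `rounds `1 `rounds ∷ []

-- Per day: monotonicity of S and T, which serves both kinds of period, then `long` for work and
-- off, `short` for work and off, and the two staffing bounds. At the boundary: `first` and `last`
-- for work and off; there, shifting by the index or by `D` gives entry 0 or 1.
dayCodes boundaryCodes : List EdgeCode
dayCodes =
  edgeCode S o S i o o ∷
  edgeCode T o T i o o ∷
  edgeCode S lw T o o o ∷
  edgeCode T lo S o o N ∷
  edgeCode T o S uw o o ∷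
  edgeCode S o T uo N o ∷
  edgeCode S o T o rl o ∷
  edgeCode T o S o o ru ∷ []
  where
  S T o i lw uw lo uo N rl ru : ℕ
  rl = `rl ∸ 5
  ru = `ru ∸ 5
  o  = `0 ∸ 5
  i  = `1 ∸ 5
  N  = `N ∸ 5
  lw = `lw ∸ 5
  uw = `uw ∸ 5
  lo = `lo ∸ 5
  uo = `uo ∸ 5
  S  = `S ∸ 5
  T  = `T ∸ 5
-- These run with index D + 1.
boundaryCodes =
  edgeCode T D S j o o ∷
  edgeCode S D T j N o ∷
  edgeCode S lw S i o o ∷
  edgeCode T lo T i N N ∷ []
  where
  S T o i j D lw lo N : ℕ
  j  = `index ∸ 5
  o  = `0 ∸ 5
  i  = `1 ∸ 5
  D  = `D ∸ 5
  N  = `N ∸ 5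
  lw = `lw ∸ 5
  lo = `lo ∸ 5
  S  = `S ∸ 5
  T  = `T ∸ 5

loadBounds dayBlock boundaryBlock : List Instr
loadBounds = add 0 `index `rl₀ ∷ load `rl 0 ∷ add 0 `index `ru₀ ∷ load `ru 0 ∷ []
dayBlock = loadBounds ++ compileAll dayCodes ++ sub `index `index `1 ∷ []
boundaryBlock = add `index `1 `D ∷ compileAll boundaryCodes ++ sub `rounds `rounds `1 ∷ []

roundLabel dayLabel boundaryLabel answerLabel : Label
roundLabel    = length initialise
dayLabel      = 3 + roundLabel
boundaryLabel = 1 + (suc dayLabel + length dayBlock)
answerLabel   = 1 + (boundaryLabel + length boundaryBlock)

-- Every round clears `excess`, so the answer depends on the last round alone. The days are visited
-- downwards from `D`, which lets `jz` end the loop.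
answerPart boundaryPart dayPart roundPart program : Program
answerPart   = jz `excess (2 + answerLabel) ∷ halt false ∷ halt true ∷ []
boundaryPart = boundaryBlock ++ jump roundLabel ∷ answerPart
dayPart      = jz `index boundaryLabel ∷ dayBlock ++ jump dayLabel ∷ boundaryPart
roundPart    = jz `rounds answerLabel ∷ const `excess 0 ∷ add `index `D `0 ∷ dayPart
program      = initialise ++ roundPart

record Block (p : Program) (l : Label) (is : List Instr) (R : Reg → ℕ) (M : ℕ → ℕ)
             (index rounds excess : ℕ) (M₁ : ℕ → ℕ) : Set where
  field
    R′       : Reg → ℕ
    reaches  : p ⊢ ⟨ l , R , M ⟩ ⟶[ length is ] ⟨ l + length is , R′ , M₁ ⟩
    excess≡  : R′ `excess ≡ R `excess + excess
    index≡   : R′ `index ≡ index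
    rounds≡  : R′ `rounds ≡ rounds
    fixed≡   : ∀ k → R′ (9 + k) ≡ R (9 + k)

block : ∀ p l is {js} R M {σ index rounds e M₁} → drop l p ≡ is ++ js → IsTrue (allStraight is) →
        run is (R , M) ≡ σ → proj₂ σ ≡ M₁ → proj₁ σ `excess ≡ R `excess + e →
        proj₁ σ `index ≡ index → proj₁ σ `rounds ≡ rounds →
        (∀ k → proj₁ σ (9 + k) ≡ R (9 + k)) → Block p l is R M index rounds e M₁
block p l is R M {R′ , M′} at-l ok refl refl excess≡ index≡ rounds≡ fixed≡ = record
  { R′ = R′ ; reaches = ⟶-block p l is (R , M) at-l ok
  ; excess≡ = excess≡ ; index≡ = index≡ ; rounds≡ = rounds≡ ; fixed≡ = fixed≡ }

dayInstrs boundaryInstrs : List EdgeCode → List Instr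
dayInstrs es = loadBounds ++ compileAll es ++ sub `index `index `1 ∷ []
boundaryInstrs es = add `index `1 `D ∷ compileAll es ++ sub `rounds `rounds `1 ∷ []

day-block : ∀ p l es {js} R M → drop l p ≡ dayInstrs es ++ js → IsTrue (allStraight (dayInstrs es)) →
            let es′ = map (meaning (environment (proj₁ (run loadBounds (R , M))))) es in
            Block p l (dayInstrs es) R M (R `index ∸ R `1) (R `rounds) (totalExcess M es′) (relaxAll M es′)
day-block p l es R M at-l ok =
  let M≡ , excess≡ , env≡ = run-compileAll es (proj₁ (run loadBounds (R , M))) M in
  block p l (dayInstrs es) R M at-l ok
    (run-++ (compileAll es) (sub `index `index `1 ∷ []) (run loadBounds (R , M)))
    M≡ excess≡ (cong₂ _∸_ (env≡ 0) (env≡ 5)) (env≡ 3) (λ k → env≡ (4 + k))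

boundary-block : ∀ p l es {js} R M → drop l p ≡ boundaryInstrs es ++ js →
                 IsTrue (allStraight (boundaryInstrs es)) →
                 let es′ = map (meaning (environment (R [ `index ↦ R `1 + R `D ]))) es in
                 Block p l (boundaryInstrs es) R M (R `1 + R `D) (R `rounds ∸ R `1)
                   (totalExcess M es′) (relaxAll M es′)
boundary-block p l es R M at-l ok =
  let M≡ , excess≡ , env≡ = run-compileAll es (R [ `index ↦ R `1 + R `D ]) M in
  block p l (boundaryInstrs es) R M at-l ok
    (run-++ (compileAll es) (sub `rounds `rounds `1 ∷ []) (R [ `index ↦ R `1 + R `D ] , M))
    M≡ excess≡ (env≡ 0) (cong₂ _∸_ (env≡ 3) (env≡ 5)) (λ k → env≡ (4 + k))

dayCost roundCost : ℕ
dayCost   = 2 + length dayBlock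
roundCost = 5 + length boundaryBlock

-- Execution of the loops

module Execution (I : Instance) where
  open Instance I

  M₀ : ℕ → ℕ
  M₀ = lookupOr 0 (encode I)

  constant : ℕ → ℕ
  constant 1  = 1
  constant 2  = D
  constant 3  = N
  constant 4  = minLength lw
  constant 5  = uw
  constant 6  = minLength lo
  constant 7  = uo
  constant 8  = 8 + D + D
  constant 9  = suc (8 + D + D + D)
  constant 10 = 7
  constant 11 = 7 + D
  constant _  = 0

  Fixed : (Reg → ℕ) → Set
  Fixed R = ∀ k → R (9 + k) ≡ constant k

  sAddr tAddr size : ℕ
  sAddr = 8 + D + D
  tAddr = suc (sAddr + D)
  size  = suc (tAddr + D)

  env : (i rl ru rounds : ℕ) → ℕ → ℕ
  env i rl ru c 0 = i
  env i rl ru c 1 = rl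
  env i rl ru c 2 = ru
  env i rl ru c 3 = c
  env i rl ru c (suc (suc (suc (suc k)))) = constant k

  environment≡env : ∀ {R} → Fixed R → ∀ k →
                    environment R k ≡ env (R `index) (R `rl) (R `ru) (R `rounds) k
  environment≡env fixed 0 = refl
  environment≡env fixed 1 = refl
  environment≡env fixed 2 = refl
  environment≡env fixed 3 = refl
  environment≡env fixed (suc (suc (suc (suc k)))) = fixed k

  -- One list serves all rounds: the staffing bounds are read from the initial memory and the round
  -- counter is fixed at 0.
  dayEdges : ℕ → List Edge
  dayEdges i = map (meaning (env i (M₀ (i + 7)) (M₀ (i + (7 + D))) 0)) dayCodes

  daysEdges : ℕ → List Edge
  daysEdges zero    = []
  daysEdges (suc n) = dayEdges (suc n) ++ daysEdges n

  boundaryEdges : List Edge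
  boundaryEdges = map (meaning (env (suc D) 0 0 0)) boundaryCodes

  edges : List Edge
  edges = daysEdges D ++ boundaryEdges

  -- Every round loads the staffing bounds afresh; since all targets lie at `sAddr` or beyond, it
  -- finds the original ones.
  Intact : (ℕ → ℕ) → Set
  Intact M = ∀ a → a < sAddr → M a ≡ M₀ a

  s≤t : ∀ i → sAddr ≤ i + tAddr
  s≤t i = ≤-trans (≤-trans (m≤m+n sAddr D) (n≤1+n _)) (m≤n+m tAddr i)

  day-targets : ∀ i → All (λ e → sAddr ≤ Edge.tgt e) (dayEdges i)
  day-targets i =
    m≤n+m sAddr i ∷ s≤t i ∷ m≤n+m sAddr _ ∷ s≤t _ ∷ s≤t i ∷
    m≤n+m sAddr i ∷ m≤n+m sAddr i ∷ s≤t i ∷ []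

  boundary-targets : All (λ e → sAddr ≤ Edge.tgt e) boundaryEdges
  boundary-targets = s≤t _ ∷ m≤n+m sAddr _ ∷ m≤n+m sAddr _ ∷ s≤t _ ∷ []

  relaxAll-intact : ∀ {M es} → All (λ e → sAddr ≤ Edge.tgt e) es → Intact M → Intact (relaxAll M es)
  relaxAll-intact {M} targets intact a a<s =
    trans (relaxAll-outside M (All.map (λ s≤tgt → <⇒≢ (<-≤-trans a<s s≤tgt)) targets)) (intact a a<s)

  i+7<s : ∀ {i} → i ≤ D → i + 7 < sAddr
  i+7<s {i} i≤D = subst (_< sAddr) (+-comm 7 i) (s≤s (≤-trans (+-monoʳ-≤ 7 i≤D) (m≤m+n (7 + D) D)))

  i+[7+D]<s : ∀ {i} → i ≤ D → i + (7 + D) < sAddr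
  i+[7+D]<s {i} i≤D = subst (_< sAddr) (+-comm (7 + D) i) (s≤s (+-monoʳ-≤ (7 + D) i≤D))

  dayBlock-relaxes : ∀ {R M i} → Fixed R → Intact M → i ≤ D → R `index ≡ i →
                     map (meaning (environment (proj₁ (run loadBounds (R , M))))) dayCodes ≡ dayEdges i
  dayBlock-relaxes {R} {M} {i} fixed intact i≤D refl = trans
    (meaning-cong {ρ′ = env i (M (i + R `rl₀)) (M (i + R `ru₀)) (R `rounds)}
      (environment≡env {proj₁ (run loadBounds (R , M))} fixed) dayCodes)
    (cong₂ (λ l u → map (meaning (env i l u 0)) dayCodes)
      (trans (cong (λ a → M (i + a)) (fixed 10)) (intact _ (i+7<s i≤D)))
      (trans (cong (λ a → M (i + a)) (fixed 11)) (intact _ (i+[7+D]<s i≤D))))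

  record DayLoop (n : ℕ) (R : Reg → ℕ) (M : ℕ → ℕ) : Set where
    field
      R′      : Reg → ℕ
      time    : ℕ
      reaches : program ⊢ ⟨ dayLabel , R , M ⟩ ⟶[ time ] ⟨ boundaryLabel , R′ , relaxAll M (daysEdges n) ⟩
      time≤   : time ≤ suc (n * (2 + length dayBlock))
      excess≡ : R′ `excess ≡ R `excess + totalExcess M (daysEdges n)
      fixed   : Fixed R′
      rounds≡ : R′ `rounds ≡ R `rounds

  dayStep : ∀ n {R M} → Fixed R → Intact M → suc n ≤ D → R `index ≡ suc n →
            Block program (suc dayLabel) dayBlock R M n (R `rounds)
              (totalExcess M (dayEdges (suc n))) (relaxAll M (dayEdges (suc n)))
  dayStep n {R} {M} fixed intact n≤D index≡ =
    subst₂ (λ k es → Block program (suc dayLabel) dayBlock R M k (R `rounds) (totalExcess M es) (relaxAll M es))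
      (cong₂ _∸_ index≡ (fixed 1)) (dayBlock-relaxes {R} {M} fixed intact n≤D index≡)
      (day-block program (suc dayLabel) dayCodes {jump dayLabel ∷ boundaryPart} R M refl _)

  dayLoop : ∀ n {R M} → Fixed R → Intact M → n ≤ D → R `index ≡ n → DayLoop n R M
  dayLoop zero {R} {M} fixed intact n≤D index≡ = record
    { R′ = R ; time = 1
    ; reaches = ⟶-jz-0 program dayLabel {is = dayBlock ++ jump dayLabel ∷ boundaryPart} refl index≡
    ; time≤ = ≤-refl ; excess≡ = sym (+-identityʳ _) ; fixed = fixed ; rounds≡ = refl }
  dayLoop (suc n) {R} {M} fixed intact n≤D index≡ = record
    { R′ = L.R′ ; time = 1 + (length dayBlock + (1 + L.time))
    ; reaches = ⟶-trans (⟶-jz-suc program dayLabel {is = dayBlock ++ jump dayLabel ∷ boundaryPart} refl index≡)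
        (⟶-trans B.reaches (⟶-trans
          (⟶-step program (suc dayLabel + length dayBlock) {is = boundaryPart} {σ = B.R′ , M₁} refl refl)
          (subst (λ M → program ⊢ ⟨ dayLabel , B.R′ , M₁ ⟩ ⟶[ L.time ] ⟨ boundaryLabel , L.R′ , M ⟩)
            (sym (relaxAll-++ M (dayEdges (suc n)) (daysEdges n))) L.reaches)))
    ; time≤ = s≤s (subst (λ t → t ≤ 2 + length dayBlock + n * (2 + length dayBlock))
        (sym (+-suc (length dayBlock) L.time))
        (subst (suc (length dayBlock + L.time) ≤_)
          (cong suc (+-suc (length dayBlock) _)) (s≤s (+-monoʳ-≤ (length dayBlock) L.time≤))))
    ; excess≡ = trans L.excess≡ (trans (cong (_+ totalExcess M₁ (daysEdges n)) B.excess≡)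
        (trans (+-assoc (R `excess) _ _) (cong (R `excess +_) (sym (totalExcess-++ M (dayEdges (suc n)) (daysEdges n))))))
    ; fixed = L.fixed ; rounds≡ = trans L.rounds≡ B.rounds≡ }
    where
    module B = Block (dayStep n {R} {M} fixed intact n≤D index≡)
    M₁ : ℕ → ℕ
    M₁ = relaxAll M (dayEdges (suc n))
    module L = DayLoop (dayLoop n {B.R′} {M₁} (λ k → trans (B.fixed≡ k) (fixed k))
      (relaxAll-intact (day-targets (suc n)) intact) (<⇒≤ n≤D) B.index≡)

  days-targets : ∀ n → All (λ e → sAddr ≤ Edge.tgt e) (daysEdges n)
  days-targets zero    = []
  days-targets (suc n) = All.++⁺ (day-targets (suc n)) (days-targets n)

  record Round (R : Reg → ℕ) (M : ℕ → ℕ) : Set where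
    field
      R′      : Reg → ℕ
      time    : ℕ
      reaches : program ⊢ ⟨ roundLabel , R , M ⟩ ⟶[ time ] ⟨ roundLabel , R′ , relaxAll M edges ⟩
      time≤   : time ≤ D * dayCost + roundCost
      excess≡ : R′ `excess ≡ totalExcess M edges
      fixed   : Fixed R′
      rounds≡ : R′ `rounds ≡ R `rounds ∸ 1

  boundaryStep : ∀ {R} → Fixed R → ∀ M →
                 Block program boundaryLabel boundaryBlock R M (R `1 + R `D) (R `rounds ∸ 1)
                   (totalExcess M boundaryEdges) (relaxAll M boundaryEdges)
  boundaryStep {R} fixed M =
    subst₂ (λ k es → Block program boundaryLabel boundaryBlock R M (R `1 + R `D) k (totalExcess M es) (relaxAll M es))
      (cong (R `rounds ∸_) (fixed 1))
      (trans (meaning-cong (environment≡env {R [ `index ↦ R `1 + R `D ]} fixed) boundaryCodes)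
        (cong (λ i → map (meaning (env i 0 0 0)) boundaryCodes) (cong₂ _+_ (fixed 1) (fixed 2))))
      (boundary-block program boundaryLabel boundaryCodes {jump roundLabel ∷ answerPart} R M refl _)

  runRound : ∀ {R M m} → Fixed R → Intact M → R `rounds ≡ suc m → Round R M
  runRound {R} {M} fixed intact rounds≡ = record
    { R′ = B.R′ ; time = 1 + (2 + (L.time + (length boundaryBlock + 1)))
    ; reaches = ⟶-trans (⟶-jz-suc program roundLabel {is = const `excess 0 ∷ add `index `D `0 ∷ dayPart} refl rounds≡)
        (⟶-trans (⟶-block program (suc roundLabel) (const `excess 0 ∷ add `index `D `0 ∷ []) {dayPart} (R , M) refl _)
        (⟶-trans L.reaches (⟶-trans B.reaches
          (subst (λ M′ → program ⊢ ⟨ boundaryLabel + length boundaryBlock , B.R′ , M₂ ⟩ ⟶[ 1 ] ⟨ roundLabel , B.R′ , M′ ⟩)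
            (sym (relaxAll-++ M (daysEdges D) boundaryEdges))
            (⟶-step program (boundaryLabel + length boundaryBlock) {is = answerPart} {σ = B.R′ , M₂} refl refl)))))
    ; time≤ = ≤-trans (+-monoʳ-≤ 3 (+-monoˡ-≤ (length boundaryBlock + 1) L.time≤)) (≤-reflexive (lemma (D * dayCost) (length boundaryBlock)))
    ; excess≡ = trans B.excess≡ (trans (cong (_+ totalExcess M₁ boundaryEdges) L.excess≡)
        (sym (totalExcess-++ M (daysEdges D) boundaryEdges)))
    ; fixed = λ k → trans (B.fixed≡ k) (L.fixed k)
    ; rounds≡ = trans B.rounds≡ (cong (_∸ 1) L.rounds≡) }
    where
    R₁ : Reg → ℕ
    R₁ = R [ `excess ↦ 0 ] [ `index ↦ R `D + R `0 ]
    M₁ M₂ : ℕ → ℕ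
    M₁ = relaxAll M (daysEdges D)
    M₂ = relaxAll M₁ boundaryEdges
    module L = DayLoop (dayLoop D {R₁} {M} fixed intact ≤-refl
      (trans (cong₂ _+_ (fixed 2) (fixed 0)) (+-identityʳ D)))
    module B = Block (boundaryStep {L.R′} L.fixed M₁)
    lemma : ∀ d b → 3 + (suc d + (b + 1)) ≡ d + (5 + b)
    lemma d b = begin
      4 + (d + (b + 1))  ≡⟨ cong (λ b → 4 + (d + b)) (+-comm b 1) ⟩
      4 + (d + suc b)    ≡⟨ cong (4 +_) (+-suc d b) ⟩
      5 + (d + b)        ≡⟨ sym (trans (+-comm d (5 + b)) (cong (5 +_) (+-comm b d))) ⟩
      d + (5 + b)        ∎
      where open ≡-Reasoning

-- Encoding of the input and correctness of the answer

lookupOr-≥ : ∀ {A : Set} (z : A) xs {i} → length xs ≤ i → lookupOr z xs i ≡ z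
lookupOr-≥ z []       _        = refl
lookupOr-≥ z (x ∷ xs) (s≤s le) = lookupOr-≥ z xs le

lookupOr-tabulate-++ : ∀ {A : Set} {n} (z : A) (g : Fin n → A) ys d →
                       lookupOr z (tabulate g ++ ys) (toℕ d) ≡ g d
lookupOr-tabulate-++ z g ys Fin.zero    = refl
lookupOr-tabulate-++ z g ys (Fin.suc d) = lookupOr-tabulate-++ z (g ∘ Fin.suc) ys d

lookupOr-++-tabulate : ∀ {A : Set} {n} (z : A) (g : Fin n → A) ys k →
                       lookupOr z (tabulate g ++ ys) (n + k) ≡ lookupOr z ys k
lookupOr-++-tabulate {n = zero}  z g ys k = refl
lookupOr-++-tabulate {n = suc n} z g ys k = lookupOr-++-tabulate z (g ∘ Fin.suc) ys k

module Correctness (I : Instance) where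
  open Instance I
  open Execution I

  M₀-rl : ∀ d → M₀ (suc (toℕ d) + 7) ≡ rl d
  M₀-rl d = trans (cong M₀ (+-comm (suc (toℕ d)) 7)) (lookupOr-tabulate-++ 0 rl (tabulate ru) d)

  M₀-ru : ∀ d → M₀ (suc (toℕ d) + (7 + D)) ≡ ru d
  M₀-ru d = begin
    M₀ (suc (toℕ d) + (7 + D))                           ≡⟨ cong M₀ (+-comm (suc (toℕ d)) (7 + D)) ⟩
    M₀ (7 + (D + suc (toℕ d)))                           ≡⟨ cong (λ k → M₀ (7 + k)) (+-suc D (toℕ d)) ⟩
    lookupOr 0 (tabulate rl ++ tabulate ru) (D + toℕ d)  ≡⟨ lookupOr-++-tabulate 0 rl (tabulate ru) (toℕ d) ⟩
    lookupOr 0 (tabulate ru) (toℕ d)                     ≡⟨ cong (λ xs → lookupOr 0 xs (toℕ d)) (sym (++-identityʳ (tabulate ru))) ⟩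
    lookupOr 0 (tabulate ru ++ []) (toℕ d)               ≡⟨ lookupOr-tabulate-++ 0 ru [] d ⟩
    ru d                                                 ∎
    where open ≡-Reasoning

  M₀-≥ : ∀ {a} → sAddr ≤ a → M₀ a ≡ 0
  M₀-≥ {a} s≤a = lookupOr-≥ 0 (encode I) (subst (_≤ a) (sym (cong (8 +_) (trans (length-++ (tabulate rl))
    (cong₂ _+_ (length-tabulate rl) (length-tabulate ru))))) s≤a)

  s<t : ∀ {i} → i ≤ D → i + sAddr < tAddr
  s<t {i} i≤D = s≤s (subst (_≤ sAddr + D) (+-comm sAddr i) (+-monoʳ-≤ sAddr i≤D))

  t<size : ∀ {i} → i ≤ D → i + tAddr < size
  t<size {i} i≤D = s≤s (subst (_≤ tAddr + D) (+-comm tAddr i) (+-monoʳ-≤ tAddr i≤D))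

  s<size : ∀ {i} → i ≤ D → i + sAddr < size
  s<size i≤D = <-trans (s<t i≤D) (s≤s (m≤m+n tAddr D))

  1+D∸l≤D : ∀ l → 1 ≤ l → suc D ∸ l ≤ D
  1+D∸l≤D l = ∸-monoʳ-≤ (suc D)

  1+D∸D≤D : suc D ∸ D ≤ D
  1+D∸D≤D = ≤-trans (≤-reflexive (m+n∸n≡m 1 D)) 1≤D

  day-below : ∀ {i} → i ≤ D → All (Below size) (dayEdges i)
  day-below {i} i≤D =
    (s<size i≤D     , s<size (i∸ 1)) ∷
    (t<size i≤D     , t<size (i∸ 1)) ∷
    (s<size (i∸ (minLength lw)) , t<size i≤D) ∷
    (t<size (i∸ (minLength lo)) , s<size i≤D) ∷
    (t<size i≤D     , s<size (i∸ uw)) ∷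
    (s<size i≤D     , t<size (i∸ uo)) ∷
    (s<size i≤D     , t<size i≤D) ∷
    (t<size i≤D     , s<size i≤D) ∷ []
    where
    i∸ : ∀ k → i ∸ k ≤ D
    i∸ k = ≤-trans (m∸n≤m i k) i≤D

  days-below : ∀ {n} → n ≤ D → All (Below size) (daysEdges n)
  days-below {zero}  _   = []
  days-below {suc n} n<D = All.++⁺ (day-below n<D) (days-below (<⇒≤ n<D))

  edges-below : All (Below size) edges
  edges-below = All.++⁺ (days-below ≤-refl)
    ( (t<size 1+D∸D≤D , s<size (1+D∸l≤D (suc D) (s≤s z≤n)))
    ∷ (s<size 1+D∸D≤D , t<size (1+D∸l≤D (suc D) (s≤s z≤n)))
    ∷ (s<size (1+D∸l≤D _ (1≤minLength lw)) , s<size ≤-refl)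
    ∷ (t<size (1+D∸l≤D _ (1≤minLength lo)) , t<size ≤-refl)
    ∷ [])

  open BellmanFord size edges edges-below

  holds⇒system : ∀ {y} → All (Holds y) edges →
                 System N D lw uw lo uo rl ru (λ i → y (i + sAddr)) (λ i → y (i + tAddr))
  holds⇒system {y} hs with All.++⁻ (daysEdges D) hs
  ... | days , S₀≤T₁ ∷ T₀+N≤S₁ ∷ S-last ∷ T-last ∷ [] = record
    { on = record
      { P-mono = λ i<D → case-day i<D λ { (h ∷ _) → cancel h }
      ; Q-mono = λ i<D → case-day i<D λ { (_ ∷ h ∷ _) → cancel h }
      ; long   = λ i<D → case-day i<D λ { (_ ∷ _ ∷ h ∷ _) → cancel h }
      ; short  = λ i<D → case-day i<D λ { (_ ∷ _ ∷ _ ∷ _ ∷ h ∷ _) → cancel h }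
      ; first  = subst₂ (λ i j → S i ≤ T j) (n∸n≡0 D) (m+n∸n≡m 1 D) (cancel S₀≤T₁)
      ; last   = cancel S-last }
    ; off = record
      { P-mono = λ i<D → case-day i<D λ { (_ ∷ h ∷ _) → +-monoˡ-≤ N (cancel h) }
      ; Q-mono = λ i<D → case-day i<D λ { (h ∷ _) → cancel h }
      ; long   = λ i<D → case-day i<D λ { (_ ∷ _ ∷ _ ∷ h ∷ _) → cancelˡ h }
      ; short  = λ i<D → case-day i<D λ { (_ ∷ _ ∷ _ ∷ _ ∷ _ ∷ h ∷ _) → cancelʳ h }
      ; first  = subst₂ (λ i j → T i + N ≤ S j) (n∸n≡0 D) (m+n∸n≡m 1 D) (cancelʳ T₀+N≤S₁)
      ; last   = T-last }
    ; staffing = λ d →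
        case-day (toℕ<n d) (λ { (_ ∷ _ ∷ _ ∷ _ ∷ _ ∷ _ ∷ h ∷ _) →
          subst (λ r → T (suc (toℕ d)) + r ≤ S (suc (toℕ d))) (M₀-rl d) (cancelʳ h) }) ,
        case-day (toℕ<n d) (λ { (_ ∷ _ ∷ _ ∷ _ ∷ _ ∷ _ ∷ _ ∷ h ∷ _) →
          subst (λ r → S (suc (toℕ d)) ≤ T (suc (toℕ d)) + r) (M₀-ru d) (cancelˡ h) })
    }
    where
    S T : ℕ → ℕ
    S i = y (i + sAddr)
    T i = y (i + tAddr)

    cancelˡ : ∀ {m n} → m + 0 ≤ n → m ≤ n
    cancelˡ {m} {n} = subst (_≤ n) (+-identityʳ m)

    cancelʳ : ∀ {m n} → m ≤ n + 0 → m ≤ n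
    cancelʳ {m} {n} = subst (m ≤_) (+-identityʳ n)

    cancel : ∀ {m n} → m + 0 ≤ n + 0 → m ≤ n
    cancel = cancelˡ ∘ cancelʳ

    day-of : ∀ {i} n → i < n → All (Holds y) (daysEdges n) → All (Holds y) (dayEdges (suc i))
    day-of (suc n) (s≤s i≤n) hs with All.++⁻ (dayEdges (suc n)) hs | m≤n⇒m<n∨m≡n i≤n
    ... | _ , hs′ | inj₁ i<n  = day-of n i<n hs′
    ... | h , _   | inj₂ refl = h

    case-day : ∀ {i} {X : Set} → i < D → (All (Holds y) (dayEdges (suc i)) → X) → X
    case-day i<D f = f (day-of D i<D days)

  system⇒holds : ∀ {S T y} → System N D lw uw lo uo rl ru S T →
                 (∀ {i} → i ≤ D → y (i + sAddr) ≡ S i) → (∀ {i} → i ≤ D → y (i + tAddr) ≡ T i) →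
                 All (Holds y) edges
  system⇒holds {S} {T} {y} sys y-S y-T = All.++⁺ (days ≤-refl)
    ( hold (y-S {suc D ∸ suc D} (1+D∸l≤D (suc D) (s≤s z≤n))) (y-T 1+D∸D≤D)
        (+-monoˡ-≤ 0 (subst₂ (λ i j → S i ≤ T j) (sym (n∸n≡0 D)) (sym (m+n∸n≡m 1 D)) (Counters.first on)))
    ∷ hold (y-T {suc D ∸ suc D} (1+D∸l≤D (suc D) (s≤s z≤n))) (y-S 1+D∸D≤D)
        (pad (subst₂ (λ i j → T i + N ≤ S j) (sym (n∸n≡0 D)) (sym (m+n∸n≡m 1 D)) (Counters.first off)))
    ∷ hold (y-S ≤-refl) (y-S (1+D∸l≤D _ (1≤minLength lw))) (+-monoˡ-≤ 0 (Counters.last on))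
    ∷ hold (y-T ≤-refl) (y-T (1+D∸l≤D _ (1≤minLength lo))) (Counters.last off)
    ∷ [])
    where
    open System sys

    hold : ∀ {a b m n p q} → y a ≡ m → y b ≡ n → m + p ≤ n + q → y a + p ≤ y b + q
    hold refl refl h = h

    pad : ∀ {m n} → m ≤ n → m ≤ n + 0
    pad {m} {n} = subst (m ≤_) (sym (+-identityʳ n))

    unpad : ∀ {m n} → m ≤ n → m + 0 ≤ n
    unpad {m} {n} = subst (_≤ n) (sym (+-identityʳ m))

    day-holds : ∀ d → All (Holds y) (dayEdges (suc (toℕ d)))
    day-holds d =
      hold (y-S (<⇒≤ d<D)) (y-S d<D) (+-monoˡ-≤ 0 (Counters.P-mono on d<D)) ∷
      hold (y-T (<⇒≤ d<D)) (y-T d<D) (+-monoˡ-≤ 0 (Counters.Q-mono on d<D)) ∷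
      hold (y-T d<D) (y-S (d∸ (minLength lw))) (+-monoˡ-≤ 0 (Counters.long on d<D)) ∷
      hold (y-S d<D) (y-T (d∸ (minLength lo))) (unpad (Counters.long off d<D)) ∷
      hold (y-S (d∸ uw)) (y-T d<D) (+-monoˡ-≤ 0 (Counters.short on d<D)) ∷
      hold (y-T (d∸ uo)) (y-S d<D) (pad (Counters.short off d<D)) ∷
      hold (y-T d<D) (y-S d<D) (pad (subst (λ r → T (suc (toℕ d)) + r ≤ S (suc (toℕ d))) (sym (M₀-rl d)) (proj₁ (staffing d)))) ∷
      hold (y-S d<D) (y-T d<D) (unpad (subst (λ r → S (suc (toℕ d)) ≤ T (suc (toℕ d)) + r) (sym (M₀-ru d)) (proj₂ (staffing d)))) ∷ []
      where
      d<D : toℕ d < D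
      d<D = toℕ<n d
      d∸ : ∀ k → suc (toℕ d) ∸ k ≤ D
      d∸ k = ≤-trans (m∸n≤m _ k) d<D

    days : ∀ {n} → n ≤ D → All (Holds y) (daysEdges n)
    days {zero}  _   = []
    days {suc n} n<D = All.++⁺
      (subst (λ n → All (Holds y) (dayEdges (suc n))) (toℕ-fromℕ< n<D) (day-holds (fromℕ< n<D)))
      (days (<⇒≤ n<D))

  -- The input cells are vertices too. Leaving them at `M₀` puts the assignment above the initial
  -- memory, whose cells for S and T are 0.
  vertices : (S T : ℕ → ℕ) → ℕ → ℕ
  vertices S T v with v <? sAddr | v <? tAddr
  ... | yes _ | _     = M₀ v
  ... | no  _ | yes _ = S (v ∸ sAddr)
  ... | no  _ | no  _ = T (v ∸ tAddr)

  module _ (S T : ℕ → ℕ) where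
    M₀≼vertices : M₀ ≼ vertices S T
    M₀≼vertices v _ with v <? sAddr | v <? tAddr
    ... | yes _  | _ = ≤-refl
    ... | no v≮s | _ = ≤-trans (≤-reflexive (M₀-≥ (≮⇒≥ v≮s))) z≤n

    vertices-S : ∀ {i} → i ≤ D → vertices S T (i + sAddr) ≡ S i
    vertices-S {i} i≤D with i + sAddr <? sAddr | i + sAddr <? tAddr
    ... | yes lt | _      = contradiction (m≤n+m sAddr i) (<⇒≱ lt)
    ... | no  _  | no ≮   = contradiction (s<t i≤D) ≮
    ... | no  _  | yes _  = cong S (m+n∸n≡m i sAddr)

    vertices-T : ∀ {i} → i ≤ D → vertices S T (i + tAddr) ≡ T i
    vertices-T {i} i≤D with i + tAddr <? sAddr | i + tAddr <? tAddr
    ... | yes lt | _      = contradiction (s≤t i) (<⇒≱ lt)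
    ... | no  _  | yes lt = contradiction (m≤n+m tAddr i) (<⇒≱ lt)
    ... | no  _  | no _   = cong T (m+n∸n≡m i tAddr)

  holds⇔feasible : IsLocal I →
    (All (Holds (rounds size M₀)) edges → DODOSP I) × (DODOSP I → All (Holds (rounds size M₀)) edges)
  holds⇔feasible local =
    solution⇒feasible I local ∘ holds⇒system ,
    λ feasible → let S , T , sys = feasible⇒solution I local feasible in
                 rounds-solve (M₀≼vertices S T)
                   (system⇒holds sys (vertices-S S T) (vertices-T S T))

  edges-targets : All (λ e → sAddr ≤ Edge.tgt e) edges
  edges-targets = All.++⁺ (days-targets D) boundary-targets

  record Rounds (k m : ℕ) (R : Reg → ℕ) : Set where
    field
      R′      : Reg → ℕ
      time    : ℕ
      reaches : program ⊢ ⟨ roundLabel , R , M₀ ⟩ ⟶[ time ] ⟨ roundLabel , R′ , rounds k M₀ ⟩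
      time≤   : time ≤ k * (D * dayCost + roundCost)
      fixed   : Fixed R′
      intact  : Intact (rounds k M₀)
      rounds≡ : R′ `rounds ≡ m

  runRounds : ∀ k m {R} → Fixed R → R `rounds ≡ k + m → Rounds k m R
  runRounds zero m {R} fixed rounds≡ = record
    { R′ = R ; time = 0 ; reaches = steps id ; time≤ = z≤n ; fixed = fixed
    ; intact = λ _ _ → refl ; rounds≡ = rounds≡ }
  runRounds (suc k) m {R} fixed rounds≡ = record
    { R′ = L.R′ ; time = B.time + L.time ; reaches = ⟶-trans B.reaches L.reaches
    ; time≤ = ≤-trans (+-mono-≤ B.time≤ L.time≤) (≤-reflexive (+-comm (k * (D * dayCost + roundCost)) _))
    ; fixed = L.fixed
    ; intact = relaxAll-intact edges-targets B.intact
    ; rounds≡ = trans L.rounds≡ (cong (_∸ 1) B.rounds≡) }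
    where
    module B = Rounds (runRounds k (suc m) {R} fixed (trans rounds≡ (sym (+-suc k m))))
    module L = Round (runRound {B.R′} {rounds k M₀} B.fixed B.intact B.rounds≡)

  Rᵢ : Reg → ℕ
  Rᵢ = proj₁ (run initialise ((λ _ → 0) , M₀))

  initialise-fixed : Fixed Rᵢ
  initialise-fixed 0  = refl
  initialise-fixed 1  = refl
  initialise-fixed 2  = refl
  initialise-fixed 3  = refl
  initialise-fixed 4  = refl
  initialise-fixed 5  = refl
  initialise-fixed 6  = refl
  initialise-fixed 7  = refl
  initialise-fixed 8  = refl
  initialise-fixed 9  = refl
  initialise-fixed 10 = refl
  initialise-fixed 11 = refl
  initialise-fixed (suc (suc (suc (suc (suc (suc (suc (suc (suc (suc (suc (suc k)))))))))))) = refl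

  halts : ∀ R M → R `rounds ≡ 0 →
          ∃ λ b → program ⊢ ⟨ roundLabel , R , M ⟩ ⇓[ 3 ] b × Reflects (R `excess ≡ 0) b
  halts R M rounds≡0 with R `excess in excess≡
  ... | zero  = true , resume (⟶-jz-0 program roundLabel {M = M} refl rounds≡0)
      (resume (⟶-jz-0 program answerLabel {R = R} {M} refl excess≡) (stop refl)) , ofʸ refl
  ... | suc _ = false , resume (⟶-jz-0 program roundLabel {M = M} refl rounds≡0)
      (resume (⟶-jz-suc program answerLabel {R = R} {M} refl excess≡) (stop refl)) , ofⁿ λ ()

  decides : IsLocal I → ∃ λ b → ∃ λ t → program ⊢ initial (encode I) ⇓[ t ] b ×
            t ≤ length initialise + (suc size * (D * dayCost + roundCost) + 3) × Reflects (DODOSP I) b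
  decides local = answer , length initialise + (B.time + (L.time + 3)) ,
    resume (⟶-block program 0 initialise {roundPart} ((λ _ → 0) , M₀) refl _)
      (resume B.reaches (resume L.reaches halted)) ,
    +-monoʳ-≤ (length initialise) (begin
      B.time + (L.time + 3)  ≡⟨ sym (+-assoc B.time L.time 3) ⟩
      B.time + L.time + 3    ≤⟨ +-monoˡ-≤ 3 (+-mono-≤ B.time≤ L.time≤) ⟩
      size * X + X + 3       ≡⟨ cong (_+ 3) (+-comm (size * X) X) ⟩
      X + size * X + 3       ∎) ,
    verdict reflects
    where
    open ≤-Reasoning
    X : ℕ
    X = D * dayCost + roundCost
    -- After `size` rounds the memory is a solution if there is any; the one remaining round
    -- measures the excess.
    module B = Rounds (runRounds size 1 {Rᵢ} initialise-fixed (+-comm 1 size))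
    module L = Round (runRound {B.R′} {rounds size M₀} B.fixed B.intact B.rounds≡)
    halting : ∃ λ b → program ⊢ ⟨ roundLabel , L.R′ , relaxAll (rounds size M₀) edges ⟩ ⇓[ 3 ] b ×
                      Reflects (L.R′ `excess ≡ 0) b
    halting = halts L.R′ _ (trans L.rounds≡ (cong (_∸ 1) B.rounds≡))
    answer : Bool
    answer = proj₁ halting
    halted   = proj₁ (proj₂ halting)
    reflects = proj₂ (proj₂ halting)
    verdict : ∀ {b} → Reflects (L.R′ `excess ≡ 0) b → Reflects (DODOSP I) b
    verdict (ofʸ idle) = ofʸ (proj₁ (holds⇔feasible local)
      (totalExcess≡0⇒holds (rounds size M₀) edges (trans (sym L.excess≡) idle)))
    verdict (ofⁿ busy) = ofⁿ λ feasible → busy (trans L.excess≡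
      (holds⇒totalExcess≡0 (rounds size M₀) edges (proj₂ (holds⇔feasible local) feasible)))

-- There are 11 + 4D rounds, counting the test, of cost at most D c₁ + c₂ each. As 1 ≤ D, these
-- factors are at most 15 D and D (c₁ + c₂), and the additive constants `e` and `k` are absorbed by
-- D².
quadratic : ∀ {D} k e → 1 ≤ D → ∀ c₁ c₂ →
            e + ((11 + (D + D + D + D)) * (D * c₁ + c₂) + k) ≤ (15 * (c₁ + c₂) + (e + k)) * D ^ 2
quadratic {D} k e 1≤D c₁ c₂ = begin
  e + ((11 + (D + D + D + D)) * (D * c₁ + c₂) + k)
    ≤⟨ +-mono-≤ (scale e) (+-mono-≤ (*-mono-≤ (+-monoˡ-≤ (D + D + D + D) (m*1≤ 11))
         (+-monoʳ-≤ (D * c₁) (≤-trans (≤-reflexive (sym (*-identityˡ c₂))) (*-monoˡ-≤ c₂ 1≤D)))) (scale k)) ⟩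
  e * (D * D) + ((11 * D + (D + D + D + D)) * (D * c₁ + D * c₂) + k * (D * D))
    ≡⟨ solve 5 (λ d a b e k → e :* (d :* d) :+ ((con 11 :* d :+ (d :+ d :+ d :+ d)) :* (d :* a :+ d :* b) :+ k :* (d :* d))
         := (con 15 :* (a :+ b) :+ (e :+ k)) :* (d :* (d :* con 1))) refl D c₁ c₂ e k ⟩
  (15 * (c₁ + c₂) + (e + k)) * D ^ 2 ∎
  where
  open ≤-Reasoning
  open +-*-Solver
  m*1≤ : ∀ m → m ≤ m * D
  m*1≤ m = ≤-trans (≤-reflexive (sym (*-identityʳ m))) (*-monoʳ-≤ m 1≤D)
  scale : ∀ m → m ≤ m * (D * D)
  scale m = ≤-trans (m*1≤ m) (*-monoʳ-≤ m (m*1≤ D))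

theorem5p1 : ∃ λ (p : Program) → ∃ λ (c : ℕ) →
    ∀ (I : Instance) → IsLocal I →
    ∃ λ (b : Bool) → ∃ λ (t : ℕ) →
    (p ⊢ initial (encode I) ⇓[ t ] b) ×
    (t ≤ c * Instance.D I ^ 2) ×
    Reflects (DODOSP I) b
theorem5p1 = program , 15 * (dayCost + roundCost) + (length initialise + 3) , λ I local →
  let b , t , halts , t≤ , reflects = Correctness.decides I local in
  b , t , halts ,
  ≤-trans t≤ (quadratic 3 (length initialise) (Instance.1≤D I) dayCost roundCost) ,
  reflects
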